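{- Let $G$ be a 3-uniform hypergraph with $m$ edges. Then there exists a partition of the vertex set of $G$ into three parts such that each part meets at least $\frac{3}{5}m$ edges.
   Context: A 3-uniform hypergraph $G$ has a finite vertex set $V$ and a set of edges, each edge being a (distinct) 3-element subset of $V$. A set of vertices meets an edge if it has nonempty intersection with it. -}

module Defs where

open import Data.Nat using (ℕ)
open import Data.Fin using (Fin)
open import Data.Fin.Subset using (Subset; ∣_∣; _∈_)
open import Data.List using (List; length; filter)
open import Data.List.Relation.Unary.All using (All)
open import Data.List.Relation.Unary.Unique.Propositional using (Unique)
open import Data.Product using (∃; _×_)
open import Relation.Binary.PropositionalEquality using (_≡_)
open import Relation.Nullary using (Dec)
open import Data.Fin.Properties using (any?)
open import Data.Fin.Subset.Properties using (_∈?_)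
open import Data.Fin using (_≟_)
open import Relation.Nullary.Decidable using (_×-dec_)

record Hypergraph3 (n : ℕ) : Set where
  field
    edges    : List (Subset n)
    uniform  : All (λ e → ∣ e ∣ ≡ 3) edges
    distinct : Unique edges

open Hypergraph3 public

numEdges : ∀ {n} → Hypergraph3 n → ℕ
numEdges G = length (edges G)

Meets : ∀ {n} → Subset n → Subset n → Set
Meets S e = ∃ λ v → v ∈ S × v ∈ e

meets? : ∀ {n} (S e : Subset n) → Dec (Meets S e)
meets? S e = any? (λ v → (v ∈? S) ×-dec (v ∈? e))

metCount : ∀ {n} → Hypergraph3 n → Subset n → ℕ
metCount G S = length (filter (meets? S) (edges G))

part : ∀ {n} → (Fin n → Fin 3) → Fin 3 → Subset n
part {n} c i = Data.Vec.tabulate (λ v → Relation.Nullary.Decidable.does (c v ≟ i))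
  where import Data.Vec

-- For a colouring c let xₚ be the number of edges missed by part P, let F = x₀ + x₁ + x₂, and let
-- t be the least integer above 2m/5.  Suppose that every colouring has a part with xₚ ≥ t, and let
-- c minimise Φ = F + max xₚ, the worst part being 2F.  Comparison with an F-minimal colouring gives
-- Φ(c) ≤ 2m − 2t, so that only part 2F is bad, and 3Φ(c) ≤ 2F(d) + 2m for every colouring d.
-- Moving v from P to 2F lowers x₂ by some α and raises xₚ by some β.  By minimality either β ≥ 2α
-- (v is light) or t − xₚ ≤ β and x₂ − xₚ ≤ 2β − α (v is heavy), and in the latter case also
-- 5x₂ + x_Q − 2m ≤ 4β − 3α for the third part Q.  Added over the vertices of a class, these become
-- linear inequalities between the numbers of edges of each type, the type of an edge being given
-- by the classes of its vertices.  They are contradictory for all numbers k ≥ l of heavy vertices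
-- in the two good parts: if k and l are small, one needs in addition that only few distinct edges
-- are spanned by the heavy vertices, and for l = 2, k ≤ 4 also integrality and a comparison of c
-- with colourings obtained by exchanging a heavy vertex for a vertex of the worst part.
module Submission where

open import Defs
open import Data.Bool using (Bool; true; false; T; _∧_; _∨_; if_then_else_)
open import Data.Bool.ListAction using (all)
open import Data.Bool.Properties using (T?; T-∧)
open import Data.Empty using (⊥; ⊥-elim)
open import Data.Fin using (Fin; zero; suc; _≟_)
open import Data.Fin.Patterns using (0F; 1F; 2F)
open import Data.Fin.Permutation.Components using (transpose)
open import Data.Fin.Properties using (all?; suc-injective)
open import Data.Fin.Subset using (Subset; ∣_∣; inside; outside; ⁅_⁆; _∪_) renaming (_∈_ to _∈ₛ_)
open import Data.Fin.Subset.Properties using (⊆-antisym; x∈⁅x⁆; x∈⁅y⁆⇒x≡y; x∈p∪q⁺; x∈p∪q⁻)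
open import Data.Integer
  using (ℤ; +_; -_; 0ℤ; 1ℤ; -1ℤ; _+_; _*_; _-_; _⊔_; _≤_; _≤ᵇ_; +≤+; nonNegative)
open import Data.Integer.Properties
  using (≤-refl; ≤-reflexive; ≤-trans; ≤-total; ≰⇒>; ≤ᵇ⇒≤; i<j⇒suc[i]≤j; i≤j⇒0≤j-i; 0≤i-j⇒j≤i;
         +-mono-≤; +-monoˡ-≤; *-monoˡ-≤-nonNeg; *-monoʳ-≤-nonNeg; +-identityˡ; +-identityʳ;
         *-zeroʳ; *-identityʳ; ⊔-sel; ⊔-lub; i≤i⊔j; i≤j⊔i)
import Data.Integer.Properties as ℤ
open import Data.Integer.Tactic.RingSolver using (solve-∀)
open import Data.List
  using (List; []; _∷_; _++_; allFin; cartesianProductWith; filter; filterᵇ; length; map)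
open import Data.List.Membership.Propositional using (_∈_; find)
open import Data.List.Membership.Propositional.Properties
  using (∈-allFin; ∈-filter⁺; ∈-filter⁻; ∈-∃++; ∈-++⁺ˡ; ∈-++⁺ʳ; ∈-++⁻; ∈-map⁺; ∈-map⁻;
         ∈-cartesianProductWith⁺)
open import Data.List.Properties using (length-++; length-map)
open import Data.List.Relation.Unary.All as All using (All; []; _∷_)
open import Data.List.Relation.Unary.All.Properties using (all⁺; ¬Any⇒All¬)
import Data.List.Relation.Unary.AllPairs.Properties as AllPairs
open import Data.List.Relation.Unary.Any using (any?; here; there)
open import Data.List.Relation.Unary.Unique.Propositional using (Unique; []; _∷_)
import Data.List.Relation.Unary.Unique.Propositional.Properties as Unique
open import Data.Nat as ℕ using (ℕ; zero; suc; z≤n; s≤s; _≡ᵇ_; _<ᵇ_)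
open import Data.Nat.DivMod using (m≡m%n+[m/n]*n; m%n<n; m/n*n≤m)
import Data.Nat.Properties as ℕ
open import Data.Product using (Σ; ∃; _×_; _,_; proj₁; proj₂)
open import Data.Sum using (_⊎_; inj₁; inj₂)
open import Data.Unit using (tt)
open import Data.Vec using ([]; _∷_; here; there)
open import Data.Vec.Functional using (head; tail) renaming (_∷_ to _▹_)
open import Data.Vec.Properties using ([]=⇒lookup; lookup⇒[]=; lookup∘tabulate)
open import Function using (_∘_)
open import Function.Bundles using (Equivalence)
open import Relation.Binary.PropositionalEquality
  using (_≡_; _≢_; refl; sym; trans; cong; cong₂; subst; subst₂)
open import Relation.Nullary using (Dec; yes; no; does; ¬_; contradiction)
open import Relation.Nullary.Decidable using (⌊_⌋; map′; toWitness; from-yes; dec-true; dec-false)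

-- An `F`-minimal colouring satisfies F + 3 max xₚ ≤ 2m. Since F ≥ max xₚ, this alone gives only max
-- xₚ ≤ m/2. To get down to 2m/5 the worst part has to win vertices from the others, and `Φ` charges
-- for the total and for the maximum at once, so that neither can be improved at the cost of the
-- other. The obstacle is the heavy vertices: moving one makes its old part the worst, and nothing
-- follows about β - 2α. What does follow is a lower bound that is the same for all heavy vertices
-- of a part, so their number enters the summed inequality as a coefficient. The bounds used in
-- `core` are nonnegative, so a refutation for k heavy vertices also serves for more than k,
-- provided that it uses no upper bound depending on k. This leaves finitely many systems. Their
-- unknowns are t, min F and the numbers of edges of each type. Each system is refuted by Farkas
-- multipliers, which are verified by evaluation.

∑ : {X : Set} → List X → (X → ℤ) → ℤ
∑ []       f = 0ℤ
∑ (x ∷ xs) f = f x + ∑ xs f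

∑-cong : {X : Set} (xs : List X) {f g : X → ℤ} → (∀ x → f x ≡ g x) → ∑ xs f ≡ ∑ xs g
∑-cong []       f≗g = refl
∑-cong (x ∷ xs) f≗g = cong₂ _+_ (f≗g x) (∑-cong xs f≗g)

∑-+ : {X : Set} (xs : List X) (f g : X → ℤ) → ∑ xs (λ x → f x + g x) ≡ ∑ xs f + ∑ xs g
∑-+ []       f g = refl
∑-+ (x ∷ xs) f g = trans (cong (λ s → f x + g x + s) (∑-+ xs f g)) (shuffle (f x) (g x) _ _)
  where
  shuffle : ∀ a b c d → a + b + (c + d) ≡ a + c + (b + d)
  shuffle = solve-∀

∑-* : {X : Set} (xs : List X) (c : ℤ) (f : X → ℤ) → ∑ xs (λ x → c * f x) ≡ c * ∑ xs f
∑-* []       c f = sym (*-zeroʳ c)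
∑-* (x ∷ xs) c f = trans (cong (λ s → c * f x + s) (∑-* xs c f)) (factor c (f x) _)
  where
  factor : ∀ c a b → c * a + c * b ≡ c * (a + b)
  factor = solve-∀

∑-mono : {X : Set} (xs : List X) {f g : X → ℤ} → (∀ x → f x ≤ g x) → ∑ xs f ≤ ∑ xs g
∑-mono []       f≤g = ≤-refl
∑-mono (x ∷ xs) f≤g = +-mono-≤ (f≤g x) (∑-mono xs f≤g)

∑-zero : {X : Set} (xs : List X) → ∑ xs (λ _ → 0ℤ) ≡ 0ℤ
∑-zero []       = refl
∑-zero (x ∷ xs) = trans (+-identityˡ _) (∑-zero xs)

∑-≥0 : {X : Set} (xs : List X) {f : X → ℤ} → (∀ x → 0ℤ ≤ f x) → 0ℤ ≤ ∑ xs f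
∑-≥0 xs {f} 0≤f = subst (λ z → z ≤ ∑ xs f) (∑-zero xs) (∑-mono xs 0≤f)

∑-swap : {X Y : Set} (xs : List X) (ys : List Y) {f : X → Y → ℤ} →
         ∑ xs (λ x → ∑ ys (f x)) ≡ ∑ ys (λ y → ∑ xs (λ x → f x y))
∑-swap []       ys     = sym (∑-zero ys)
∑-swap (x ∷ xs) ys {f} = trans (cong (λ s → ∑ ys (f x) + s) (∑-swap xs ys)) (sym (∑-+ ys _ _))

infixr 6 _⊳_
_⊳_ : Bool → ℤ → ℤ
true  ⊳ z = z
false ⊳ z = 0ℤ

∑-none : ∀ {n} (xs : List (Fin n)) {u : Fin n} (g : Fin n → ℤ) → All (u ≢_) xs →
         ∑ xs (λ v → does (v ≟ u) ⊳ g v) ≡ 0ℤ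
∑-none []       g []           = refl
∑-none (x ∷ xs) {u} g (u≢x ∷ u∉xs) with x ≟ u
... | yes refl = contradiction refl u≢x
... | no  _    = trans (+-identityˡ _) (∑-none xs g u∉xs)

∑-single : ∀ {n} {xs : List (Fin n)} {u : Fin n} (g : Fin n → ℤ) → Unique xs → u ∈ xs →
           ∑ xs (λ v → does (v ≟ u) ⊳ g v) ≡ g u
∑-single {xs = x ∷ xs} {u} g (x∉xs ∷ _) (here refl) with x ≟ x
... | yes _   = trans (cong (λ s → g x + s) (∑-none xs g x∉xs)) (+-identityʳ _)
... | no  x≢x = contradiction refl x≢x
∑-single {xs = x ∷ xs} {u} g (x∉xs ∷ xs!) (there u∈xs) with x ≟ u
... | yes refl = contradiction refl (All.lookup x∉xs u∈xs)
... | no  _    = trans (+-identityˡ _) (∑-single g xs! u∈xs)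

∑-δ : ∀ {n} (g : Fin n → ℤ) (u : Fin n) → ∑ (allFin n) (λ v → does (v ≟ u) ⊳ g v) ≡ g u
∑-δ {n} g u = ∑-single g (Unique.allFin⁺ n) (∈-allFin u)

∀³ : {L : Set} → List L → (L → L → L → Bool) → Bool
∀³ xs P = all (λ x → all (λ y → all (P x y) xs) xs) xs

∀³-sound : {L : Set} (xs : List L) (P : L → L → L → Bool) → T (∀³ xs P) →
           ∀ {x y z} → x ∈ xs → y ∈ xs → z ∈ xs → T (P x y z)
∀³-sound xs P ok {x} {y} x∈ y∈ z∈ = All.lookup (all⁺ (P x y) xs okʸ) z∈
  where
  okˣ = All.lookup (all⁺ (λ x → all (λ y → all (P x y) xs) xs) xs ok) x∈
  okʸ = All.lookup (all⁺ (λ y → all (P x y) xs) xs okˣ) y∈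

-- Edges as vertex triples, and the effect of recolouring one vertex

record Triple {n} (s : Subset n) : Set where
  field
    {p q r} : Fin n
    p≢q     : p ≢ q
    p≢r     : p ≢ r
    q≢r     : q ≢ r
    p∈s     : p ∈ₛ s
    q∈s     : q ∈ₛ s
    r∈s     : r ∈ₛ s
    cover   : ∀ {v} → v ∈ₛ s → v ≡ p ⊎ v ≡ q ⊎ v ≡ r

-- Functions of labels are evaluated on the ordered triple. The subset is kept because distinctness
-- of edges is a property of subsets.
Edge : ℕ → Set
Edge n = Σ (Subset n) Triple

module _ {L : Set} where

  spread : (L → L → L → ℤ) → L → L → L → ℤ
  spread g x y z = g x y z + g y x z + g z x y

  gain : (L → L → L → ℤ) → L → L → L → L → ℤ
  gain f t x y z = f t y z - f x y z

  record Symmetric (f : L → L → L → ℤ) : Set where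
    field
      swap   : ∀ x y z → f x y z ≡ f y x z
      rotate : ∀ x y z → f x y z ≡ f z x y

module _ {n : ℕ} {L : Set} where

  on : (L → L → L → ℤ) → (Fin n → L) → Edge n → ℤ
  on f ℓ (_ , e) = f (ℓ p) (ℓ q) (ℓ r) where open Triple e

  -- The first argument of g is the label of v itself.
  local : (L → L → L → ℤ) → (Fin n → L) → Fin n → Edge n → ℤ
  local g ℓ v (_ , e) = (does (v ≟ p) ⊳ g (ℓ v) (ℓ q) (ℓ r))
                      + (does (v ≟ q) ⊳ g (ℓ v) (ℓ p) (ℓ r))
                      + (does (v ≟ r) ⊳ g (ℓ v) (ℓ p) (ℓ q))
    where open Triple e

  infixl 7 _[_↦_]
  _[_↦_] : (Fin n → L) → Fin n → L → Fin n → L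
  (ℓ [ v ↦ t ]) u = if does (v ≟ u) then t else ℓ u

  -- The vertices of an edge are distinct, so v occupies at most one position. Symmetry of f brings
  -- that position to the front, where `gain` changes the label.
  move-local : ∀ {f} → Symmetric f → ∀ ℓ v t e →
               on f (ℓ [ v ↦ t ]) e ≡ on f ℓ e + local (gain f t) ℓ v e
  move-local {f} f-sym ℓ v t (_ , e) with v ≟ Triple.p e | v ≟ Triple.q e | v ≟ Triple.r e
  ... | yes refl | yes refl | _        = contradiction refl (Triple.p≢q e)
  ... | yes refl | _        | yes refl = contradiction refl (Triple.p≢r e)
  ... | _        | yes refl | yes refl = contradiction refl (Triple.q≢r e)
  ... | yes refl | no _     | no _     = lemma (f t _ _) (f _ _ _)
    where
    lemma : ∀ a b → a ≡ b + (a - b + 0ℤ + 0ℤ)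
    lemma = solve-∀
  ... | no _     | yes refl | no _     =
    trans (lemma (f _ t _) (f _ _ _)) (cong₂ (λ a b → f _ _ _ + (0ℤ + (a - b) + 0ℤ)) (swap _ _ _)
        (swap _ _ _))
    where
    open Symmetric f-sym
    lemma : ∀ a b → a ≡ b + (0ℤ + (a - b) + 0ℤ)
    lemma = solve-∀
  ... | no _     | no _     | yes refl =
    trans (lemma (f _ _ t) (f _ _ _)) (cong₂ (λ a b → f _ _ _ + (0ℤ + 0ℤ + (a - b))) (rotate _ _ _)
        (rotate _ _ _))
    where
    open Symmetric f-sym
    lemma : ∀ a b → a ≡ b + (0ℤ + 0ℤ + (a - b))
    lemma = solve-∀
  ... | no _     | no _     | no _     = lemma (f _ _ _)
    where
    lemma : ∀ a → a ≡ a + (0ℤ + 0ℤ + 0ℤ)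
    lemma = solve-∀

module _ {n : ℕ} (E : List (Edge n)) {L : Set} where

  ⟨_∣_⟩ : (L → L → L → ℤ) → (Fin n → L) → ℤ
  ⟨ f ∣ ℓ ⟩ = ∑ E (on f ℓ)

  at : (L → L → L → ℤ) → (Fin n → L) → Fin n → ℤ
  at g ℓ v = ∑ E (local g ℓ v)

  move : ∀ {f} → Symmetric f → ∀ ℓ v t → ⟨ f ∣ ℓ [ v ↦ t ] ⟩ ≡ ⟨ f ∣ ℓ ⟩ + at (gain f t) ℓ v
  move f-sym ℓ v t = trans (∑-cong E (move-local f-sym ℓ v t)) (∑-+ E _ _)

  -- An edge contributes to `at` only at its own three vertices. In this way conditions at single
  -- vertices become linear conditions on the numbers of edges of each type.
  double-count : ∀ g ℓ → ∑ (allFin n) (at g ℓ) ≡ ⟨ spread g ∣ ℓ ⟩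
  double-count g ℓ = trans (∑-swap (allFin n) E) (∑-cong E per-edge)
    where
    per-edge : ∀ e → ∑ (allFin n) (λ v → local g ℓ v e) ≡ on (spread g) ℓ e
    per-edge (_ , e) = trans (∑-+ (allFin n) _ _) (cong₂ _+_ (trans (∑-+ (allFin n) _ _) (cong₂ _+_
      (∑-δ (λ v → g (ℓ v) (ℓ q) (ℓ r)) p) (∑-δ (λ v → g (ℓ v) (ℓ p) (ℓ r)) q)))
      (∑-δ (λ v → g (ℓ v) (ℓ p) (ℓ q)) r))
      where open Triple e

-- Refuting systems of linear inequalities between edge counts

-- `A` and `B` stand for the light vertices of the good parts `0F` and `1F`, `a` and `b` for their
-- heavy vertices, and `C` for all vertices of the worst part `2F`.
data Class : Set where
  A B C a b : Class

classes : List Class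
classes = A ∷ B ∷ C ∷ a ∷ b ∷ []

class∈ : ∀ x → x ∈ classes
class∈ A = here refl
class∈ B = there (here refl)
class∈ C = there (there (here refl))
class∈ a = there (there (there (here refl)))
class∈ b = there (there (there (there (here refl))))

-- An affine form in t, F₀ = min F and the numbers of edges of each type.
record Form : Set where
  constructor form
  field
    density            : Class → Class → Class → ℤ
    coeffₜ coeff₀ const : ℤ

open Form

infixl 6 _⊕_
_⊕_ : Form → Form → Form
form f p q r ⊕ form f′ p′ q′ r′ = form (λ x y z → f x y z + f′ x y z) (p + p′) (q + q′) (r + r′)

infixl 7 _⊙_
_⊙_ : ℤ → Form → Form
k ⊙ form f p q r = form (λ x y z → k * f x y z) (k * p) (k * q) (k * r)

zeroForm : Form
zeroForm = form (λ _ _ _ → 0ℤ) 0ℤ 0ℤ 0ℤ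

-- Over ℤ, the negation of 0 ≤ φ is 0 ≤ complement φ.
complement : Form → Form
complement φ = -1ℤ ⊙ φ ⊕ form (λ _ _ _ → 0ℤ) 0ℤ 0ℤ -1ℤ

combination : List ℕ → List Form → Form
combination (zero ∷ ys) (φ ∷ φs) = combination ys φs
combination (y    ∷ ys) (φ ∷ φs) = + y ⊙ φ ⊕ combination ys φs
combination _           _        = zeroForm

-- `weights` are Farkas multipliers, and `split` uses integrality: either φ ≥ 0 or φ ≤ -1. Each
-- branch puts its new form in front, so the first weight belongs to the innermost split.
data Certificate : Set where
  weights : List ℕ → Certificate
  split   : Form → Certificate → Certificate → Certificate

-- Numbers of edges are nonnegative, so nonpositive coefficients suffice for them. The quantities t
-- and F₀ are treated as free variables and have to cancel exactly.
negative : Form → Bool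
negative (form f p q r) =
  (∀³ classes λ x y z → f x y z ≤ᵇ 0ℤ) ∧ ⌊ p ℤ.≟ 0ℤ ⌋ ∧ ⌊ q ℤ.≟ 0ℤ ⌋ ∧ (1ℤ + r ≤ᵇ 0ℤ)

refutes : List Form → Certificate → Bool
refutes φs (weights ys)  = negative (combination ys φs)
refutes φs (split φ c d) = refutes (φ ∷ φs) c ∧ refutes (complement φ ∷ φs) d

module Farkas {n} (E : List (Edge n)) (cls : Fin n → Class) (t F₀ : ℤ) where

  value : Form → ℤ
  value (form f p q r) = ⟨_∣_⟩ E f cls + (p * t + q * F₀ + r)

  Holds : Form → Set
  Holds φ = 0ℤ ≤ value φ

  value-⊕ : ∀ φ ψ → value (φ ⊕ ψ) ≡ value φ + value ψ
  value-⊕ (form f p q r) (form f′ p′ q′ r′) =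
    trans (cong (_+ _) (∑-+ E (on f cls) (on f′ cls)))
        (lemma (⟨_∣_⟩ E f cls) (⟨_∣_⟩ E f′ cls) p p′ q q′ r r′ t F₀)
    where
    lemma : ∀ s s′ p p′ q q′ r r′ t F → s + s′ + ((p + p′) * t + (q + q′) * F + (r + r′))
            ≡ s + (p * t + q * F + r) + (s′ + (p′ * t + q′ * F + r′))
    lemma = solve-∀

  value-⊙ : ∀ k φ → value (k ⊙ φ) ≡ k * value φ
  value-⊙ k (form f p q r) = trans (cong (_+ _) (∑-* E k (on f cls)))
      (lemma k (⟨_∣_⟩ E f cls) p q r t F₀)
    where
    lemma : ∀ k s p q r t F → k * s + (k * p * t + k * q * F + k * r) ≡ k *
        (s + (p * t + q * F + r))
    lemma = solve-∀

  combination-holds : ∀ ys {φs} → All Holds φs → Holds (combination ys φs)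
  combination-holds []           hs       = zero-holds
    where
    zero-holds : Holds zeroForm
    zero-holds = ≤-reflexive (sym (trans (cong (_+ _) (∑-zero E)) (lemma t F₀)))
      where
      lemma : ∀ t F → 0ℤ + (0ℤ * t + 0ℤ * F + 0ℤ) ≡ 0ℤ
      lemma = solve-∀
  combination-holds (zero  ∷ ys) []       = combination-holds [] []
  combination-holds (suc y ∷ ys) []       = combination-holds [] []
  combination-holds (zero  ∷ ys) (_ ∷ hs) = combination-holds ys hs
  combination-holds (suc y ∷ ys) {φ ∷ φs} (h ∷ hs) =
    subst (0ℤ ≤_) (sym (trans (value-⊕ (+ suc y ⊙ φ) (combination ys φs))
        (cong (_+ _) (value-⊙ (+ suc y) φ))))
      (+-mono-≤ (subst (_≤ + suc y * value φ) (*-zeroʳ (+ suc y)) (*-monoˡ-≤-nonNeg (+ suc y) h))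
          (combination-holds ys hs))

  complement-holds : ∀ φ → ¬ Holds φ → Holds (complement φ)
  complement-holds φ ¬h = subst (0ℤ ≤_) (sym value-complement) (i≤j⇒0≤j-i (i<j⇒suc[i]≤j (≰⇒> ¬h)))
    where
    lemma : ∀ v t F → -1ℤ * v + (0ℤ + (0ℤ * t + 0ℤ * F + -1ℤ)) ≡ 0ℤ - (1ℤ + v)
    lemma = solve-∀
    value-complement : value (complement φ) ≡ 0ℤ - (1ℤ + value φ)
    value-complement = trans (value-⊕ (-1ℤ ⊙ φ) (form (λ _ _ _ → 0ℤ) 0ℤ 0ℤ -1ℤ))
      (trans (cong₂ _+_ (value-⊙ -1ℤ φ) (cong (_+ _) (∑-zero E))) (lemma (value φ) t F₀))

  nonpositive : (Class → Class → Class → ℤ) → Class → Class → Class → Bool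
  nonpositive f x y z = f x y z ≤ᵇ 0ℤ

  negative-fails : ∀ φ → T (negative φ) → ¬ Holds φ
  negative-fails (form f p q r) ok h
    with f≤0 , ok′ ← Equivalence.to (T-∧ {∀³ classes (nonpositive f)}) ok
    with p≡0 , ok″ ← Equivalence.to (T-∧ {⌊ p ℤ.≟ 0ℤ ⌋}) ok′
    with q≡0 , r<0 ← Equivalence.to (T-∧ {⌊ q ℤ.≟ 0ℤ ⌋}) ok″
    with refl ← toWitness {a? = p ℤ.≟ 0ℤ} p≡0
    with refl ← toWitness {a? = q ℤ.≟ 0ℤ} q≡0
    = absurd (≤-trans (+-mono-≤ (≤-refl {1ℤ}) (≤-trans h v≤r)) (≤ᵇ⇒≤ r<0))
    where
    absurd : ¬ (1ℤ + 0ℤ ≤ 0ℤ)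
    absurd (+≤+ ())
    lemma : ∀ r t F → 0ℤ + (0ℤ * t + 0ℤ * F + r) ≡ r
    lemma = solve-∀
    sum≤0 : ⟨_∣_⟩ E f cls ≤ 0ℤ
    sum≤0 = subst (⟨_∣_⟩ E f cls ≤_) (∑-zero E)
      (∑-mono E λ _ → ≤ᵇ⇒≤ (∀³-sound classes (nonpositive f) f≤0 (class∈ _) (class∈ _) (class∈ _)))
    v≤r : value (form f 0ℤ 0ℤ r) ≤ r
    v≤r = subst (value (form f 0ℤ 0ℤ r) ≤_) (lemma r t F₀) (+-monoˡ-≤ _ sum≤0)

  refute : ∀ φs c → All Holds φs → T (refutes φs c) → ⊥
  refute φs (weights ys)  hs ok = negative-fails (combination ys φs) ok (combination-holds ys hs)
  refute φs (split φ c d) hs ok with Equivalence.to (T-∧ {refutes (φ ∷ φs) c}) ok | 0ℤ ℤ.≤? value φ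
  ... | okᶜ , _   | yes h = refute (φ ∷ φs) c (h ∷ hs) okᶜ
  ... | _   , okᵈ | no ¬h = refute (complement φ ∷ φs) d (complement-holds φ ¬h ∷ hs) okᵈ

-- The inequalities at an extremal colouring, as forms

miss : Fin 3 → Fin 3 → Fin 3 → Fin 3 → ℤ
miss P x y z = if does (P ≟ x) ∨ does (P ≟ y) ∨ does (P ≟ z) then 0ℤ else 1ℤ

colour : Class → Fin 3
colour A = 0F
colour B = 1F
colour C = 2F
colour a = 0F
colour b = 1F

rank : Class → ℕ
rank A = 0
rank B = 1
rank C = 2
rank a = 3
rank b = 4

unrank : ℕ → Class
unrank 0 = A
unrank 1 = B
unrank 2 = C
unrank 3 = a
unrank _ = b

unrank-rank : ∀ x → unrank (rank x) ≡ x
unrank-rank A = refl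
unrank-rank B = refl
unrank-rank C = refl
unrank-rank a = refl
unrank-rank b = refl

_≟ᶜ_ : (x y : Class) → Dec (x ≡ y)
x ≟ᶜ y = map′ (λ eq → trans (sym (unrank-rank x)) (trans (cong unrank eq) (unrank-rank y)))
              (cong rank) (rank x ℕ.≟ rank y)

Density : Set
Density = Class → Class → Class → ℤ

missed : Fin 3 → Density
missed P x y z = miss P (colour x) (colour y) (colour z)

-- When a vertex of class x, in part P ≠ 2F, is moved to part 2F, then β counts the edges
-- that P no longer meets and α those that 2F starts to meet.
β α : Density
β x y z = gain (miss (colour x)) 2F (colour x) (colour y) (colour z)
α x y z = - gain (miss 2F) 2F (colour x) (colour y) (colour z)

only : Class → Density → Density
only c g x y z = does (x ≟ᶜ c) ⊳ g x y z

edgeCount totalMissed : Density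
edgeCount   _ _ _ = 1ℤ
totalMissed x y z = missed 0F x y z + missed 1F x y z + missed 2F x y z

infix 4 _≥_
_≥_ : Density → ℕ → Form
f ≥ k = form f 0ℤ 0ℤ (- + k)

-- By double counting, the first summand is the sum of g over the vertices of class c. Nonnegativity
-- says that it is at least k times φ.
vertexForm : Class → Density → ℕ → Form → Form
vertexForm c g k φ = form (spread (only c g)) 0ℤ 0ℤ 0ℤ ⊕ (- + k) ⊙ φ

gᴺ g₁ g₂ g₀ : Density
gᴺ x y z = β x y z - + 2 * α x y z
g₁ x y z = + 4 * β x y z - + 3 * α x y z
g₂ x y z = + 2 * β x y z - α x y z
g₀ x y z = β x y z - α x y z

-- gᴺ is nonnegative at light vertices.  At a heavy vertex of part P the values g₁, g₂, β and g₀ are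
-- at least φ₁ Q, φ₂ P, φ₃ P and φ₀ respectively, Q being the third part.
φ₁ : Fin 3 → Form
φ₁ Q = form (λ x y z → + 5 * missed 2F x y z + missed Q x y z - + 2) 0ℤ 0ℤ 0ℤ

φ₂ φ₃ : Fin 3 → Form
φ₂ P = form (λ x y z → missed 2F x y z - missed P x y z) 0ℤ 0ℤ 0ℤ
φ₃ P = form (λ x y z → - missed P x y z) 1ℤ 0ℤ 0ℤ

φ₀ : Form
φ₀ = form (λ x y z → - totalMissed x y z) 0ℤ 1ℤ 0ℤ

exceeds attains : Form
exceeds = form (λ _ _ _ → - + 2) (+ 5) 0ℤ -1ℤ
attains = form (missed 2F) -1ℤ 0ℤ 0ℤ

core : ℕ → ℕ → List Form
core k l =
  exceeds ∷ attains ∷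
  vertexForm A gᴺ 0 zeroForm ∷ vertexForm B gᴺ 0 zeroForm ∷
  vertexForm a g₁ k (φ₁ 1F) ∷ vertexForm a g₂ k (φ₂ 0F) ∷ vertexForm a β k (φ₃ 0F) ∷
  vertexForm b g₁ l (φ₁ 0F) ∷ vertexForm b g₂ l (φ₂ 1F) ∷ vertexForm b β l (φ₃ 1F) ∷ []

multiplicity : Class → Class → Class → Class → ℕ
multiplicity c x y z = unit x ℕ.+ (unit y ℕ.+ unit z)
  where
  unit : Class → ℕ
  unit u = if does (u ≟ᶜ c) then 1 else 0

-- A sum of terms -1 is nonnegative only if it is empty, so the form forbids these types of edges.
-- `barren` uses the same encoding.
few : Class → ℕ → Form
few c k = form (λ x y z → if k <ᵇ multiplicity c x y z then -1ℤ else 0ℤ) 0ℤ 0ℤ 0ℤ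

mixed : Class → Class → ℕ → Form
mixed c d k =
  form (λ x y z → if (multiplicity c x y z ≡ᵇ 2) ∧ (multiplicity d x y z ≡ᵇ 1) then -1ℤ else 0ℤ)
       0ℤ 0ℤ (+ k)

choose₂ : ℕ → ℕ
choose₂ zero    = 0
choose₂ (suc k) = k ℕ.+ choose₂ k

-- The upper bounds `few` and `mixed` depend on exact numbers of heavy vertices. `atLeast` retains
-- only the one for class `b`, so it stays valid when class `a` has more than k members. `optimal`
-- adds the comparisons with the minimum of `F`.
atLeast exactly optimal : ℕ → ℕ → List Form
atLeast k l = few b l ∷ core k l
exactly k l = few a k ∷ few b l ∷ mixed a b (choose₂ k ℕ.* l) ∷ mixed b a (choose₂ l ℕ.* k) ∷ core k
    l
optimal k l =
  form (λ x y z → + 2 - + 3 * (totalMissed x y z + missed 2F x y z)) 0ℤ (+ 2) 0ℤ ∷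
  form totalMissed 0ℤ -1ℤ 0ℤ ∷
  vertexForm a g₀ k φ₀ ∷ vertexForm b g₀ l φ₀ ∷ exactly k l

isFin : Fin 3 → Fin 3 → ℕ
isFin P x = if does (P ≟ x) then 1 else 0

multiplicityᶠ : Fin 3 → Class → Class → Class → ℕ
multiplicityᶠ P x y z = isFin P (colour x) ℕ.+ (isFin P (colour y) ℕ.+ isFin P (colour z))

-- When a vertex of `2F` joins P, an edge through it that is `untouched` by P is missed by one part
-- fewer. An edge through it that is `crowded` by P is missed by one part more, because it has no
-- other vertex in `2F`.
untouched crowded : Fin 3 → Density
untouched P x y z = if (multiplicityᶠ P x y z ≡ᵇ 0) ∧ (1 <ᵇ multiplicityᶠ 2F x y z) then 1ℤ else 0ℤ
crowded   P x y z = if (multiplicityᶠ P x y z ≡ᵇ 2) ∧ (0 <ᵇ multiplicityᶠ 2F x y z) then 1ℤ else 0ℤ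

barren : Fin 3 → Form
barren P = form (λ x y z → - untouched P x y z) 0ℤ 0ℤ 0ℤ

-- Each heavy vertex leaves P in one of two colourings, hence `g₀` with coefficient 1. The vertex
-- entering P does so in both, hence the factors 2. A form cannot single out that vertex, so the
-- edges damaged by its move are bounded by all edges of suitable types: those counted by β at light
-- vertices and the `crowded` ones. The constant -2 is one `untouched` edge, improved in both
-- colourings.
exchange : Fin 3 → Class → Class → Form
exchange P light heavy = form (λ x y z → + 2 * totalMissed x y z + spread (only heavy g₀) x y z
  + + 2 * (spread (only light β) x y z + (crowded 0F x y z + crowded 1F x y z))) 0ℤ (- + 2) (- + 2)

-- Sums over the vertices of one class

⊳-zero : ∀ c → c ⊳ 0ℤ ≡ 0ℤ
⊳-zero true  = refl
⊳-zero false = refl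

⊳-mono : ∀ {P : Set} (d : Dec P) {x y} → (P → x ≤ y) → does d ⊳ x ≤ does d ⊳ y
⊳-mono (yes p) x≤y = x≤y p
⊳-mono (no _)  x≤y = ≤-refl

⊳-linear : ∀ c k l {x y z} → x ≡ k * y + l * z → c ⊳ x ≡ k * (c ⊳ y) + l * (c ⊳ z)
⊳-linear true  k l eq = eq
⊳-linear false k l eq = lemma k l
  where
  lemma : ∀ k l → 0ℤ ≡ k * 0ℤ + l * 0ℤ
  lemma = solve-∀

_and_gives_ : ∀ {i j k} → 0ℤ ≤ i → 0ℤ ≤ j → i + j ≡ k → 0ℤ ≤ k
p and q gives eq = subst (0ℤ ≤_) eq (+-mono-≤ p q)

scale : ∀ k {i} → 0ℤ ≤ i → 0ℤ ≤ + k * i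
scale k {i} p = subst (_≤ + k * i) (*-zeroʳ (+ k)) (*-monoˡ-≤-nonNeg (+ k) p)

module _ {n} (E : List (Edge n)) {L : Set} (ℓ : Fin n → L) (v : Fin n) where

  at-linear : ∀ k l {f g h} → (∀ y z → f (ℓ v) y z ≡ k * g (ℓ v) y z + l * h (ℓ v) y z) →
              at E f ℓ v ≡ k * at E g ℓ v + l * at E h ℓ v
  at-linear k l {f} {g} {h} eq = trans (∑-cong E per-edge)
      (trans (∑-+ E _ _) (cong₂ _+_ (∑-* E k _) (∑-* E l _)))
    where
    distribute : ∀ k l a b c a′ b′ c′ → (k * a + l * a′) + (k * b + l * b′) + (k * c + l * c′)
                 ≡ k * (a + b + c) + l * (a′ + b′ + c′)
    distribute = solve-∀
    per-edge : ∀ e → local f ℓ v e ≡ k * local g ℓ v e + l * local h ℓ v e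
    per-edge (_ , e) = trans
      (cong₂ _+_ (cong₂ _+_ (⊳-linear (does (v ≟ p)) k l (eq _ _))
          (⊳-linear (does (v ≟ q)) k l (eq _ _)))
                 (⊳-linear (does (v ≟ r)) k l (eq _ _)))
      (distribute k l _ _ _ _ _ _)
      where open Triple e

  at-ext : ∀ {f g} → (∀ y z → f (ℓ v) y z ≡ g (ℓ v) y z) → at E f ℓ v ≡ at E g ℓ v
  at-ext eq = ∑-cong E λ (_ , e) → let open Triple e in
    cong₂ _+_ (cong₂ _+_ (cong (does (v ≟ p) ⊳_) (eq (ℓ q) (ℓ r)))
        (cong (does (v ≟ q) ⊳_) (eq (ℓ p) (ℓ r))))
              (cong (does (v ≟ r) ⊳_) (eq (ℓ p) (ℓ q)))

  at-zero : ∀ {f} → (∀ y z → f (ℓ v) y z ≡ 0ℤ) → at E f ℓ v ≡ 0ℤ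
  at-zero {f} eq = trans (at-ext {f} {λ _ _ _ → 0ℤ} eq) (trans (∑-cong E per-edge) (∑-zero E))
    where
    per-edge : ∀ e → local (λ _ _ _ → 0ℤ) ℓ v e ≡ 0ℤ
    per-edge (_ , e) = cong₂ _+_ (cong₂ _+_ (⊳-zero (does (v ≟ p))) (⊳-zero (does (v ≟ q))))
        (⊳-zero (does (v ≟ r)))
      where open Triple e

  at-cong : ∀ g (m : Fin n → L) → (∀ u → ℓ u ≡ m u) → at E g ℓ v ≡ at E g m v
  at-cong g m ℓ≗m = ∑-cong E per-edge
    where
    term : ∀ c y z → c ⊳ g (ℓ v) (ℓ y) (ℓ z) ≡ c ⊳ g (m v) (m y) (m z)
    term c y z rewrite ℓ≗m v | ℓ≗m y | ℓ≗m z = refl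
    per-edge : ∀ e → local g ℓ v e ≡ local g m v e
    per-edge (_ , e) = cong₂ _+_ (cong₂ _+_ (term (does (v ≟ p)) q r) (term (does (v ≟ q)) p r))
        (term (does (v ≟ r)) p q)
      where open Triple e

module Counting {n} (E : List (Edge n)) (cls : Fin n → Class) (t F₀ : ℤ) where

  open Farkas E cls t F₀ public

  count : Class → ℤ
  count c = ∑ (allFin n) (λ v → does (cls v ≟ᶜ c) ⊳ 1ℤ)

  at-only : ∀ c g v → at E (only c g) cls v ≡ does (cls v ≟ᶜ c) ⊳ at E g cls v
  at-only c g v = trans (∑-cong E λ (_ , e) → out (does (cls v ≟ᶜ c)) (does (v ≟ Triple.p e))
      (does (v ≟ Triple.q e)) (does (v ≟ Triple.r e)) _ _ _)
                        (∑-out (does (cls v ≟ᶜ c)) E (local g cls v))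
    where
    out : ∀ k c₁ c₂ c₃ x y z → (c₁ ⊳ k ⊳ x) + (c₂ ⊳ k ⊳ y) + (c₃ ⊳ k ⊳ z) ≡ k ⊳
        ((c₁ ⊳ x) + (c₂ ⊳ y) + (c₃ ⊳ z))
    out true  c₁ c₂ c₃ x y z = refl
    out false c₁ c₂ c₃ x y z = cong₂ _+_ (cong₂ _+_ (⊳-zero c₁) (⊳-zero c₂)) (⊳-zero c₃)
    ∑-out : ∀ {X : Set} k (xs : List X) f → ∑ xs (λ x → k ⊳ f x) ≡ k ⊳ ∑ xs f
    ∑-out true  xs f = refl
    ∑-out false xs f = ∑-zero xs

  -- The last hypothesis is stated as an inequality of products to cover three situations: φ = 0 at
  -- light vertices, φ ≥ 0 with at least k vertices, and φ of any sign with exactly k vertices.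
  vertexForm-holds : ∀ c g k φ → (∀ v → cls v ≡ c → value φ ≤ at E g cls v) →
                     + k * value φ ≤ count c * value φ → Holds (vertexForm c g k φ)
  vertexForm-holds c g k φ bound few = subst (0ℤ ≤_) (sym value-vertexForm)
      (i≤j⇒0≤j-i (≤-trans few sum-bound))
    where
    pointwise : ∀ v → does (cls v ≟ᶜ c) ⊳ value φ ≤ at E (only c g) cls v
    pointwise v = subst (_ ≤_) (sym (at-only c g v)) (⊳-mono (cls v ≟ᶜ c) (bound v))
    factor : ∀ v → does (cls v ≟ᶜ c) ⊳ value φ ≡ value φ * (does (cls v ≟ᶜ c) ⊳ 1ℤ)
    factor v with does (cls v ≟ᶜ c)
    ... | true  = sym (*-identityʳ _)
    ... | false = sym (*-zeroʳ (value φ))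
    total : ∑ (allFin n) (λ v → does (cls v ≟ᶜ c) ⊳ value φ) ≡ count c * value φ
    total = trans (∑-cong (allFin n) factor) (trans (∑-* (allFin n) (value φ) _)
        (ℤ.*-comm (value φ) (count c)))
    sum-bound : count c * value φ ≤ ⟨_∣_⟩ E (spread (only c g)) cls
    sum-bound = subst₂ _≤_ total (double-count E (only c g) cls) (∑-mono (allFin n) pointwise)
    lemma : ∀ s t F k w → s + (0ℤ * t + 0ℤ * F + 0ℤ) + - k * w ≡ s - k * w
    lemma = solve-∀
    value-vertexForm : value (vertexForm c g k φ) ≡ ⟨_∣_⟩ E (spread (only c g)) cls - + k * value φ
    value-vertexForm = trans (value-⊕ (form (spread (only c g)) 0ℤ 0ℤ 0ℤ) ((- + k) ⊙ φ))
      (trans (cong (λ s → value (form (spread (only c g)) 0ℤ 0ℤ 0ℤ) + s) (value-⊙ (- + k) φ))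
             (lemma (⟨_∣_⟩ E (spread (only c g)) cls) t F₀ (+ k) (value φ)))

-- Extremal colourings

total : Fin 3 → Fin 3 → Fin 3 → ℤ
total x y z = miss 0F x y z + miss 1F x y z + miss 2F x y z

miss-symmetric : ∀ P → Symmetric (miss P)
miss-symmetric P = record { swap = swap P ; rotate = rotate P }
  where
  swap : ∀ P x y z → miss P x y z ≡ miss P y x z
  swap = from-yes (all? λ P → all? λ x → all? λ y → all? λ z → miss P x y z ℤ.≟ miss P y x z)
  rotate : ∀ P x y z → miss P x y z ≡ miss P z x y
  rotate = from-yes (all? λ P → all? λ x → all? λ y → all? λ z → miss P x y z ℤ.≟ miss P z x y)

total-symmetric : Symmetric total
total-symmetric = record
  { swap   = λ x y z → cong₂ _+_ (cong₂ _+_ (swap (miss-symmetric 0F) x y z)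
      (swap (miss-symmetric 1F) x y z)) (swap (miss-symmetric 2F) x y z)
  ; rotate = λ x y z → cong₂ _+_ (cong₂ _+_ (rotate (miss-symmetric 0F) x y z)
      (rotate (miss-symmetric 1F) x y z)) (rotate (miss-symmetric 2F) x y z)
  }
  where open Symmetric

data Side : Fin 3 → Fin 3 → Set where
  left  : Side 0F 1F
  right : Side 1F 0F

gain-other : ∀ {P Q} → Side P Q → ∀ y z → gain (miss Q) 2F P y z ≡ 0ℤ
gain-other left  = from-yes (all? λ y → all? λ z → gain (miss 1F) 2F 0F y z ℤ.≟ 0ℤ)
gain-other right = from-yes (all? λ y → all? λ z → gain (miss 0F) 2F 1F y z ℤ.≟ 0ℤ)

gain-total : ∀ {P Q} → Side P Q → ∀ y z →
             gain total 2F P y z ≡ 1ℤ * gain (miss P) 2F P y z + 1ℤ * gain (miss 2F) 2F P y z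
gain-total left  = from-yes (all? λ y → all? λ z →
    gain total 2F 0F y z ℤ.≟ 1ℤ * gain (miss 0F) 2F 0F y z + 1ℤ * gain (miss 2F) 2F 0F y z)
gain-total right = from-yes (all? λ y → all? λ z →
    gain total 2F 1F y z ℤ.≟ 1ℤ * gain (miss 1F) 2F 1F y z + 1ℤ * gain (miss 2F) 2F 1F y z)

-1≱0 : ¬ (0ℤ ≤ -1ℤ)
-1≱0 ()

∑-linear : {X : Set} (xs : List X) (k l : ℤ) (f g : X → ℤ) →
    ∑ xs (λ x → k * f x + l * g x) ≡ k * ∑ xs f + l * ∑ xs g
∑-linear xs k l f g = trans (∑-+ xs _ _) (cong₂ _+_ (∑-* xs k f) (∑-* xs l g))

module Partition {n} (E : List (Edge n)) where

  x : Fin 3 → (Fin n → Fin 3) → ℤ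
  x P c = ⟨_∣_⟩ E (miss P) c

  F top Φ : (Fin n → Fin 3) → ℤ
  F c   = ⟨_∣_⟩ E total c
  top c = x 0F c ⊔ x 1F c ⊔ x 2F c
  Φ c   = F c + top c

  m : ℤ
  m = ∑ E (λ _ → 1ℤ)

  F≡ : ∀ c → F c ≡ x 0F c + x 1F c + x 2F c
  F≡ c = trans (∑-+ E _ _) (cong (_+ x 2F c) (∑-+ E _ _))

  ⟨⟩-cong : ∀ {L : Set} (f : L → L → L → ℤ) {ℓ ℓ′ : Fin n → L} → (∀ v → ℓ v ≡ ℓ′ v) →
      ⟨_∣_⟩ E f ℓ ≡ ⟨_∣_⟩ E f ℓ′
  ⟨⟩-cong f {ℓ} {ℓ′} eq = ∑-cong E per-edge
    where
    per-edge : ∀ e → on f ℓ e ≡ on f ℓ′ e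
    per-edge (_ , e) rewrite eq (Triple.p e) | eq (Triple.q e) | eq (Triple.r e) = refl

  top-cong : ∀ {c d} → (∀ v → c v ≡ d v) → top c ≡ top d
  top-cong eq = cong₂ _⊔_ (cong₂ _⊔_ (⟨⟩-cong (miss 0F) eq) (⟨⟩-cong (miss 1F) eq))
      (⟨⟩-cong (miss 2F) eq)

  Φ-cong : ∀ {c d} → (∀ v → c v ≡ d v) → Φ c ≡ Φ d
  Φ-cong eq = cong₂ _+_ (⟨⟩-cong total eq) (top-cong eq)

  x-nonneg : ∀ P c → 0ℤ ≤ x P c
  x-nonneg P c = ∑-≥0 E λ (_ , e) → let open Triple e in pointwise P (c p) (c q) (c r)
    where
    pointwise : ∀ P x y z → 0ℤ ≤ miss P x y z
    pointwise = from-yes (all? λ P → all? λ x → all? λ y → all? λ z → 0ℤ ℤ.≤? miss P x y z)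

  x≤top : ∀ P c → x P c ≤ top c
  x≤top 0F c = ≤-trans (i≤i⊔j _ _) (i≤i⊔j _ _)
  x≤top 1F c = ≤-trans (i≤j⊔i (x 0F c) _) (i≤i⊔j _ _)
  x≤top 2F c = i≤j⊔i (x 0F c ⊔ x 1F c) _

  top-attained : ∀ c → top c ≡ x 0F c ⊎ top c ≡ x 1F c ⊎ top c ≡ x 2F c
  top-attained c with ⊔-sel (x 0F c ⊔ x 1F c) (x 2F c)
  ... | inj₂ eq = inj₂ (inj₂ eq)
  ... | inj₁ eq with ⊔-sel (x 0F c) (x 1F c)
  ...   | inj₁ eq′ = inj₁ (trans eq eq′)
  ...   | inj₂ eq′ = inj₂ (inj₁ (trans eq eq′))

  top-lub : ∀ c {k} → (∀ P → x P c ≤ k) → top c ≤ k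
  top-lub c bound = ⊔-lub (⊔-lub (bound 0F) (bound 1F)) (bound 2F)

  -- No single vertex can be moved into P profitably; these conditions are added up.
  F-min-bound : ∀ c → (∀ d → F c ≤ F d) → ∀ P → F c + + 3 * x P c ≤ + 2 * m
  F-min-bound c F-min P = 0≤i-j⇒j≤i (subst (0ℤ ≤_) (trans eq₁ eq₂) (≤-trans sum≥0 bound))
    where
    stable : ∀ v → 0ℤ ≤ at E (gain total P) c v
    stable v = subst (0ℤ ≤_) (trans (cong (_- F c) (move E total-symmetric c v P)) (cancel (F c) _))
        (i≤j⇒0≤j-i (F-min (c [ v ↦ P ])))
      where
      cancel : ∀ a b → a + b - a ≡ b
      cancel = solve-∀
    sum≥0 : 0ℤ ≤ ⟨_∣_⟩ E (spread (gain total P)) c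
    sum≥0 = subst (0ℤ ≤_) (double-count E (gain total P) c) (∑-≥0 (allFin n) stable)
    -- Equality holds for all colour patterns except one vertex in P and two in the same other part,
    -- where there is 1 to spare. The right side is nested so as to match two uses of `∑-linear`.
    pointwise : ∀ P x y z → spread (gain total P) x y z ≤ 1ℤ * (+ 2 * 1ℤ + -1ℤ * total x y z) + - +
        3 * miss P x y z
    pointwise = from-yes (all? λ P → all? λ x → all? λ y → all? λ z →
        spread (gain total P) x y z ℤ.≤? 1ℤ * (+ 2 * 1ℤ + -1ℤ * total x y z) + - + 3 * miss P x y z)
    bound : ⟨_∣_⟩ E (spread (gain total P)) c ≤ ∑ E
        (λ e → 1ℤ * (+ 2 * 1ℤ + -1ℤ * on total c e) + - + 3 * on (miss P) c e)
    bound = ∑-mono E λ (_ , e) → let open Triple e in pointwise P (c p) (c q) (c r)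
    eq₁ : ∑ E (λ e → 1ℤ * (+ 2 * 1ℤ + -1ℤ * on total c e) + - + 3 * on (miss P) c e)
          ≡ 1ℤ * (+ 2 * m + -1ℤ * F c) + - + 3 * x P c
    eq₁ = trans (∑-linear E 1ℤ (- + 3) _ _) (cong (λ s → 1ℤ * s + - + 3 * x P c)
        (∑-linear E (+ 2) -1ℤ _ _))
    eq₂ : 1ℤ * (+ 2 * m + -1ℤ * F c) + - + 3 * x P c ≡ + 2 * m - (F c + + 3 * x P c)
    eq₂ = ring m (F c) (x P c)
      where
      ring : ∀ m f x → 1ℤ * (+ 2 * m + -1ℤ * f) + - + 3 * x ≡ + 2 * m - (f + + 3 * x)
      ring = solve-∀

  -- The minimum F₀ of `F` is a separate parameter because it may be attained at a colouring other
  -- than c. `Φ-bound` and `Φ-small` record the comparison with that colouring.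
  record Minimal (t F₀ : ℤ) (c : Fin n → Fin 3) : Set where
    field
      margin  : + 2 * m + 1ℤ ≤ + 5 * t
      bad     : ∀ d → t ≤ top d
      F-min   : ∀ d → F₀ ≤ F d
      Φ-min   : ∀ d → Φ c ≤ Φ d
      Φ-bound : + 3 * Φ c ≤ + 2 * F₀ + + 2 * m
      Φ-small : Φ c ≤ + 2 * m - + 2 * t

  record Extremal (t F₀ : ℤ) (c : Fin n → Fin 3) : Set where
    field
      minimal : Minimal t F₀ c
      worst   : ∀ P → x P c ≤ x 2F c
    open Minimal minimal public

  module _ {t F₀ c} (ext : Extremal t F₀ c) where

    open Extremal ext

    top≡ : top c ≡ x 2F c
    top≡ = ℤ.≤-antisym (top-lub c worst) (x≤top 2F c)

    -- If P also missed t edges, then Φ would be at least xₚ + 2x₂ ≥ 3t, whereas Φ ≤ 2m - 2t ≤ 3t -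
    -- 1.
    others-good : ∀ {P Q} → Side P Q → 1ℤ ≤ t - x P c
    others-good side = 0≤i-j⇒j≤i (subst (0ℤ ≤_) refl (not-bad side))
      where
      ring : ∀ f₀ f₁ f₂ m t → (+ 5 * t - (+ 2 * m + 1ℤ)) + (+ 2 * m - + 2 * t - (f₀ + f₁ + f₂ + f₂))
          ≡ + 3 * t - 1ℤ - (f₀ + f₁ + f₂ + f₂)
      ring = solve-∀
      slack : 0ℤ ≤ + 3 * t - 1ℤ - (x 0F c + x 1F c + x 2F c + x 2F c)
      slack = i≤j⇒0≤j-i margin and subst (λ s → 0ℤ ≤ + 2 * m - + 2 * t - s) (cong₂ _+_ (F≡ c) top≡)
          (i≤j⇒0≤j-i Φ-small)
              gives ring (x 0F c) (x 1F c) (x 2F c) m t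
      not-bad : ∀ {P Q} → Side P Q → 0ℤ ≤ t - x P c - 1ℤ
      not-bad {P} {Q} side with 0ℤ ℤ.≤? t - x P c - 1ℤ
      ... | yes ok = ok
      ... | no ¬ok = ⊥-elim (absurd side (bad′ ¬ok))
        where
        bad′ : ¬ (0ℤ ≤ t - x P c - 1ℤ) → 0ℤ ≤ x P c - t
        bad′ ¬ok = subst (0ℤ ≤_) (r (x P c) t) (i≤j⇒0≤j-i (ℤ.i<j⇒suc[i]≤j (ℤ.≰⇒> ¬ok)))
          where
          r : ∀ x t → 0ℤ - (1ℤ + (t - x - 1ℤ)) ≡ x - t
          r = solve-∀
        absurd : ∀ {P Q} → Side P Q → 0ℤ ≤ x P c - t → ⊥
        absurd left  h = -1≱0 ((((slack and scale 3 h gives refl) and scale 2 (i≤j⇒0≤j-i (worst 0F))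
            gives refl) and x-nonneg 1F c
                              gives r (x 0F c) (x 1F c) (x 2F c) t))
          where
          r : ∀ f₀ f₁ f₂ t → + 3 * t - 1ℤ - (f₀ + f₁ + f₂ + f₂) + + 3 * (f₀ - t) + + 2 * (f₂ - f₀) +
              f₁ ≡ -1ℤ
          r = solve-∀
        absurd right h = -1≱0 ((((slack and scale 3 h gives refl) and scale 2 (i≤j⇒0≤j-i (worst 1F))
            gives refl) and x-nonneg 0F c
                              gives r (x 0F c) (x 1F c) (x 2F c) t))
          where
          r : ∀ f₀ f₁ f₂ t → + 3 * t - 1ℤ - (f₀ + f₁ + f₂ + f₂) + + 3 * (f₁ - t) + + 2 * (f₂ - f₁) +
              f₀ ≡ -1ℤ
          r = solve-∀

    module _ {P Q} (side : Side P Q) (v : Fin n) (cv : c v ≡ P) where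

      private
        u w : ℤ
        u = at E (gain (miss P) 2F) c v
        w = at E (gain (miss 2F) 2F) c v
        d : Fin n → Fin 3
        d = c [ v ↦ 2F ]

        at-v : ∀ {f k l g h} → (∀ y z → f P y z ≡ k * g P y z + l * h P y z) →
            at E f c v ≡ k * at E g c v + l * at E h c v
        at-v {f} {k} {l} {g} {h} eq = at-linear E c v k l {f} {g} {h}
            (subst (λ p → ∀ y z → f p y z ≡ k * g p y z + l * h p y z) (sym cv) eq)

        F-move : F d ≡ F c + (u + w)
        F-move = trans (move E total-symmetric c v 2F)
            (cong (λ s → F c + s) (trans (at-v {gain total 2F} {1ℤ} {1ℤ} {gain (miss P) 2F}
            {gain (miss 2F) 2F} (gain-total side)) (ring u w)))
          where
          ring : ∀ u w → 1ℤ * u + 1ℤ * w ≡ u + w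
          ring = solve-∀

        own-move : x P d ≡ x P c + u
        own-move = move E (miss-symmetric P) c v 2F

        worst-move : x 2F d ≡ x 2F c + w
        worst-move = move E (miss-symmetric 2F) c v 2F

        other-move : x Q d ≡ x Q c
        other-move = trans (move E (miss-symmetric Q) c v 2F) (trans (cong (λ s → x Q c + s)
          (at-zero E c v {gain (miss Q) 2F} (subst (λ p → ∀ y z → gain (miss Q) 2F p y z ≡ 0ℤ)
              (sym cv) (gain-other side)))) (ℤ.+-identityʳ _))

        improve : 0ℤ ≤ u + w + top d - x 2F c
        improve = subst (0ℤ ≤_) eq (i≤j⇒0≤j-i (Φ-min d))
          where
          ring : ∀ f s u w t → f + s + t - (f + u) ≡ s + t - u
          ring = solve-∀
          eq : Φ d - Φ c ≡ u + w + top d - x 2F c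
          eq = trans (cong₂ (λ p q → p + top d - (F c + q)) F-move top≡)
              (ring (F c) (u + w) (x 2F c) w (top d))

        attained : ∀ {P Q} → Side P Q → top d ≡ x P d ⊎ top d ≡ x Q d ⊎ top d ≡ x 2F d
        attained left  = top-attained d
        attained right with top-attained d
        ... | inj₁ eq        = inj₂ (inj₁ eq)
        ... | inj₂ (inj₁ eq) = inj₁ eq
        ... | inj₂ (inj₂ eq) = inj₂ (inj₂ eq)

        flip : ∀ {P Q} → Side P Q → Side Q P
        flip left  = right
        flip right = left

      F-stable : F₀ - F c ≤ u + w
      F-stable = 0≤i-j⇒j≤i (subst (0ℤ ≤_) (trans (cong (_- F₀) F-move) (ring (F c) (u + w) F₀))
          (i≤j⇒0≤j-i (F-min d)))
        where
        ring : ∀ f s g → f + s - g ≡ s - (g - f)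
        ring = solve-∀

      -- The alternative is decided by the part that is worst after the move. It cannot be Q, whose
      -- good count is unchanged while some part must be bad. If it is P, then P has become bad,
      -- which gives the first heavy inequality; minimality of `Φ` gives the second one, and also
      -- the light one if the worst part is still `2F`.
      light-or-heavy : 0ℤ ≤ u + + 2 * w ⊎ (t - x P c ≤ u × x 2F c - x P c ≤ + 2 * u + w)
      light-or-heavy with attained side
      ... | inj₂ (inj₂ eq) = inj₁ (subst (0ℤ ≤_)
          (trans (cong (λ s → u + w + s - x 2F c) (trans eq worst-move)) (ring u w (x 2F c)))
          improve)
        where
        ring : ∀ u w s → u + w + (s + w) - s ≡ u + + 2 * w
        ring = solve-∀
      ... | inj₂ (inj₁ eq) = ⊥-elim (-1≱0 (subst (0ℤ ≤_) refl
          (i≤j⇒0≤j-i (others-good (flip side)) and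
                i≤j⇒0≤j-i (subst (t ≤_) (trans eq other-move) (bad d)) gives ring t (x Q c))))
        where
        ring : ∀ t s → t - s - 1ℤ + (s - t) ≡ -1ℤ
        ring = solve-∀
      ... | inj₁ eq = inj₂
        ( 0≤i-j⇒j≤i (subst (0ℤ ≤_) (ring₁ u t (x P c))
            (i≤j⇒0≤j-i (subst (t ≤_) (trans eq own-move) (bad d))))
        , 0≤i-j⇒j≤i (subst (0ℤ ≤_) (trans (cong (λ s → u + w + s - x 2F c) (trans eq own-move))
            (ring₂ u w (x P c) (x 2F c))) improve) )
        where
        ring₁ : ∀ u t s → s + u - t ≡ u - (t - s)
        ring₁ = solve-∀
        ring₂ : ∀ u w s r → u + w + (s + u) - r ≡ + 2 * u + w - (r - s)
        ring₂ = solve-∀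

-- Light and heavy vertices of an extremal colouring

classify : Fin 3 → Bool → Class
classify 0F true  = A
classify 0F false = a
classify 1F true  = B
classify 1F false = b
classify 2F _     = C

colour-classify : ∀ P light → colour (classify P light) ≡ P
colour-classify 0F true  = refl
colour-classify 0F false = refl
colour-classify 1F true  = refl
colour-classify 1F false = refl
colour-classify 2F _     = refl

data Light : Class → Set where
  A-light : Light A
  B-light : Light B

data Heavy : Fin 3 → Fin 3 → Class → Set where
  a-heavy : Heavy 0F 1F a
  b-heavy : Heavy 1F 0F b

classify-light : ∀ {k} {X : Set} → Light k → ∀ y (d : Dec X) → classify y ⌊ d ⌋ ≡ k → X
classify-light l       _  (yes x) _  = x
classify-light A-light 0F (no _) ()
classify-light A-light 1F (no _) ()
classify-light A-light 2F (no _) ()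
classify-light B-light 0F (no _) ()
classify-light B-light 1F (no _) ()
classify-light B-light 2F (no _) ()

classify-heavy : ∀ {P Q k} {X : Set} → Heavy P Q k → ∀ y (d : Dec X) → classify y ⌊ d ⌋ ≡ k → ¬ X
classify-heavy h       _  (no ¬x) _  = ¬x
classify-heavy a-heavy 0F (yes _) ()
classify-heavy a-heavy 1F (yes _) ()
classify-heavy a-heavy 2F (yes _) ()
classify-heavy b-heavy 0F (yes _) ()
classify-heavy b-heavy 1F (yes _) ()
classify-heavy b-heavy 2F (yes _) ()

γ : Fin 3 → Density
γ P x y z = gain (miss P) 2F (colour x) (colour y) (colour z)

module Classification {n} (E : List (Edge n)) {t F₀ : ℤ} (c : Fin n → Fin 3)
    (ext : Partition.Extremal E t F₀ c) where

  open Partition E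

  balance : (Fin n → Fin 3) → Fin n → ℤ
  balance d v = at E (gain (miss (d v)) 2F) d v + + 2 * at E (gain (miss 2F) 2F) d v

  -- The test is the light inequality itself, so a vertex satisfying both alternatives is light, and
  -- a heavy vertex can only be in the second one.
  cls : Fin n → Class
  cls v = classify (c v) ⌊ 0ℤ ℤ.≤? balance c v ⌋

  -- This agrees with c pointwise but factors through the class by definition. Densities evaluated
  -- on `cls` are thereby literally quantities of the colouring `parts`, to which extremality is
  -- transported by `ext′`.
  parts : Fin n → Fin 3
  parts = colour ∘ cls

  parts≗c : ∀ v → parts v ≡ c v
  parts≗c v = colour-classify (c v) _

  balance≡ : ∀ v → balance parts v ≡ balance c v
  balance≡ v rewrite parts≗c v = cong₂ (λ p q → p + + 2 * q)
      (at-cong E parts v (gain (miss (c v)) 2F) c parts≗c)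
                                      (at-cong E parts v (gain (miss 2F) 2F) c parts≗c)

  ext′ : Extremal t F₀ parts
  ext′ = record
    { minimal = record
      { margin  = margin
      ; bad     = bad
      ; F-min   = F-min
      ; Φ-min   = λ d → subst (_≤ Φ d) (sym (Φ-cong parts≗c)) (Φ-min d)
      ; Φ-bound = subst (λ s → + 3 * s ≤ + 2 * F₀ + + 2 * m) (sym (Φ-cong parts≗c)) Φ-bound
      ; Φ-small = subst (_≤ + 2 * m - + 2 * t) (sym (Φ-cong parts≗c)) Φ-small
      }
    ; worst   = λ P → subst₂ _≤_ (sym (⟨⟩-cong (miss P) parts≗c)) (sym (⟨⟩-cong (miss 2F) parts≗c))
        (worst P)
    }
    where open Extremal ext

  open Counting E cls t F₀ public

  light-balance : ∀ {k} → Light k → ∀ v → cls v ≡ k → 0ℤ ≤ balance parts v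
  light-balance l v eq = subst (0ℤ ≤_) (sym (balance≡ v))
      (classify-light l (c v) (0ℤ ℤ.≤? balance c v) eq)

  heavy-balance : ∀ {P Q k} → Heavy P Q k → ∀ v → cls v ≡ k → ¬ (0ℤ ≤ balance parts v)
  heavy-balance h v eq ok = classify-heavy h (c v) (0ℤ ℤ.≤? balance c v) eq
      (subst (0ℤ ≤_) (balance≡ v) ok)

  module _ (v : Fin n) where

    u w : ℤ
    u = at E (gain (miss (parts v)) 2F) parts v
    w = at E (γ 2F) cls v

    at-combination : ∀ {g} k l → (∀ y z → g (cls v) y z ≡ k * β (cls v) y z + l * γ 2F (cls v) y z)
        →
                     at E g cls v ≡ k * u + l * w
    at-combination {g} k l eq = at-linear E cls v k l {g} {β} {γ 2F} eq

    at-gᴺ : at E gᴺ cls v ≡ u + + 2 * w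
    at-gᴺ = trans (at-combination {gᴺ} 1ℤ (+ 2) (λ y z → ring (β (cls v) y z) (γ 2F (cls v) y z)))
        (cong (_+ + 2 * w) (ℤ.*-identityˡ u))
      where
      ring : ∀ p q → p - + 2 * - q ≡ 1ℤ * p + + 2 * q
      ring = solve-∀

    at-g₁ : at E g₁ cls v ≡ + 4 * u + + 3 * w
    at-g₁ = at-combination {g₁} (+ 4) (+ 3) (λ y z → ring (β (cls v) y z) (γ 2F (cls v) y z))
      where
      ring : ∀ p q → + 4 * p - + 3 * - q ≡ + 4 * p + + 3 * q
      ring = solve-∀

    at-g₂ : at E g₂ cls v ≡ + 2 * u + w
    at-g₂ = trans (at-combination {g₂} (+ 2) 1ℤ (λ y z → ring (β (cls v) y z) (γ 2F (cls v) y z)))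
        (cong (λ s → + 2 * u + s) (ℤ.*-identityˡ w))
      where
      ring : ∀ p q → + 2 * p - - q ≡ + 2 * p + 1ℤ * q
      ring = solve-∀

    at-g₀ : at E g₀ cls v ≡ u + w
    at-g₀ = trans (at-combination {g₀} 1ℤ 1ℤ (λ y z → ring (β (cls v) y z) (γ 2F (cls v) y z)))
        (cong₂ _+_ (ℤ.*-identityˡ u) (ℤ.*-identityˡ w))
      where
      ring : ∀ p q → p - - q ≡ 1ℤ * p + 1ℤ * q
      ring = solve-∀

  x₂ : ℤ
  x₂ = x 2F parts

  value-φ₁ : ∀ Q → value (φ₁ Q) ≡ + 5 * x₂ + x Q parts - + 2 * m
  value-φ₁ Q = trans (cong (_+ (0ℤ * t + 0ℤ * F₀ + 0ℤ))
      (trans (∑-cong E λ (_ , e) → let open Triple e in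
      pw (missed 2F (cls p) (cls q) (cls r)) (missed Q (cls p) (cls q) (cls r)))
      (trans (∑-linear E 1ℤ (- + 2) (λ e → + 5 * on (missed 2F) cls e + 1ℤ * on (missed Q) cls e)
          (λ _ → 1ℤ))
        (cong (λ s → 1ℤ * s + - + 2 * m) (∑-linear E (+ 5) 1ℤ (on (missed 2F) cls)
            (on (missed Q) cls))))))
      (ring x₂ (x Q parts) m t F₀)
    where
    pw : ∀ p q → + 5 * p + q - + 2 ≡ 1ℤ * (+ 5 * p + 1ℤ * q) + - + 2 * 1ℤ
    pw = solve-∀
    ring : ∀ p q m t F → 1ℤ * (+ 5 * p + 1ℤ * q) + - + 2 * m + (0ℤ * t + 0ℤ * F + 0ℤ) ≡ + 5 * p + q
        - + 2 * m
    ring = solve-∀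

  value-φ₂ : ∀ P → value (φ₂ P) ≡ x₂ - x P parts
  value-φ₂ P = trans (cong (_+ (0ℤ * t + 0ℤ * F₀ + 0ℤ))
      (trans (∑-cong E λ (_ , e) → let open Triple e in
      pw (missed 2F (cls p) (cls q) (cls r)) (missed P (cls p) (cls q) (cls r)))
      (∑-linear E 1ℤ -1ℤ (on (missed 2F) cls) (on (missed P) cls))))
      (ring x₂ (x P parts) t F₀)
    where
    pw : ∀ p q → p - q ≡ 1ℤ * p + -1ℤ * q
    pw = solve-∀
    ring : ∀ p q t F → 1ℤ * p + -1ℤ * q + (0ℤ * t + 0ℤ * F + 0ℤ) ≡ p - q
    ring = solve-∀

  ∑-neg : ∀ f → ∑ E (λ e → - f e) ≡ - ∑ E f
  ∑-neg f = trans (∑-cong E λ e → sym (ℤ.-1*i≡-i (f e))) (trans (∑-* E -1ℤ f) (ℤ.-1*i≡-i (∑ E f)))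

  value-φ₃ : ∀ P → value (φ₃ P) ≡ t - x P parts
  value-φ₃ P = trans (cong (_+ (1ℤ * t + 0ℤ * F₀ + 0ℤ)) (∑-neg (on (missed P) cls)))
      (ring (x P parts) t F₀)
    where
    ring : ∀ q t F → - q + (1ℤ * t + 0ℤ * F + 0ℤ) ≡ t - q
    ring = solve-∀

  value-φ₀ : value φ₀ ≡ F₀ - F parts
  value-φ₀ = trans (cong (_+ (0ℤ * t + 1ℤ * F₀ + 0ℤ)) (∑-neg (on totalMissed cls)))
      (ring (F parts) t F₀)
    where
    ring : ∀ q t F → - q + (0ℤ * t + 1ℤ * F + 0ℤ) ≡ F - q
    ring = solve-∀

  value-0 : value zeroForm ≡ 0ℤ
  value-0 = trans (cong (_+ (0ℤ * t + 0ℤ * F₀ + 0ℤ)) (∑-zero E)) (ring t F₀)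
    where
    ring : ∀ t F → 0ℤ + (0ℤ * t + 0ℤ * F + 0ℤ) ≡ 0ℤ
    ring = solve-∀

  heavy-side : ∀ {P Q k} → Heavy P Q k → Side P Q
  heavy-side a-heavy = left
  heavy-side b-heavy = right

  heavy-colour : ∀ {P Q k} → Heavy P Q k → colour k ≡ P
  heavy-colour a-heavy = refl
  heavy-colour b-heavy = refl

  open Extremal ext′

  x₂-bad : 0ℤ ≤ x₂ - t
  x₂-bad = i≤j⇒0≤j-i (subst (t ≤_) (top≡ ext′) (bad parts))

  F-sides : ∀ {P Q} → Side P Q → F parts ≡ x P parts + x Q parts + x₂
  F-sides left  = F≡ parts
  F-sides right = trans (F≡ parts) (cong (_+ x₂) (ℤ.+-comm (x 0F parts) (x 1F parts)))

  light-holds : ∀ {k} → Light k → Holds (vertexForm k gᴺ 0 zeroForm)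
  light-holds {k = k} l = vertexForm-holds k gᴺ 0 zeroForm
    (λ v eq → subst₂ _≤_ (sym value-0) (sym (at-gᴺ v)) (light-balance l v eq))
    (≤-reflexive (trans (cong (+ 0 *_) value-0)
        (sym (trans (cong (count k *_) value-0) (*-zeroʳ (count k))))))

  module HeavyForms {P Q k} (h : Heavy P Q k) where

    private
      side = heavy-side h

    parts≡ : ∀ {v} → cls v ≡ k → parts v ≡ P
    parts≡ eq = trans (cong colour eq) (heavy-colour h)

    u≡ : ∀ {v} → cls v ≡ k → at E (gain (miss P) 2F) parts v ≡ u v
    u≡ {v} eq = cong (λ R → at E (gain (miss R) 2F) parts v) (sym (parts≡ eq))

    expensive : ∀ v → cls v ≡ k → t - x P parts ≤ u v × x₂ - x P parts ≤ + 2 * u v + w v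
    expensive v eq with light-or-heavy ext′ side v (parts≡ eq)
    ... | inj₁ light = ⊥-elim (heavy-balance h v eq
        (subst (λ s → 0ℤ ≤ s + + 2 * w v) (u≡ eq) light))
    ... | inj₂ heavy = subst (λ s → t - x P parts ≤ s × x₂ - x P parts ≤ + 2 * s + w v) (u≡ eq)
        heavy

    stable : ∀ v → cls v ≡ k → F₀ - F parts ≤ u v + w v
    stable v eq = subst (λ s → F₀ - F parts ≤ s + w v) (u≡ eq) (F-stable ext′ side v (parts≡ eq))

    -- Three inequalities are added: x₂ - xₚ ≤ 2β - α, twice F₀ - F ≤ β - α, and 3(F + x₂) ≤ 2F₀ +
    -- 2m. Both F₀ and xₚ cancel.
    g₁-bound : ∀ v → cls v ≡ k → value (φ₁ Q) ≤ at E g₁ cls v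
    g₁-bound v eq = subst₂ _≤_ (sym (value-φ₁ Q)) (sym (at-g₁ v)) (0≤i-j⇒j≤i
      ((i≤j⇒0≤j-i (proj₂ (expensive v eq)) and scale 2 (i≤j⇒0≤j-i (stable v eq)) gives refl) and
          i≤j⇒0≤j-i Φ-bound
       gives trans (cong₂ (λ f s → + 2 * u v + w v - (x₂ - x P parts) + + 2 * (u v + w v - (F₀ - f))
           + (+ 2 * F₀ + + 2 * m - + 3 * (f + s)))
                          (F-sides side) (top≡ ext′))
                   (ring (u v) (w v) (x P parts) (x Q parts) x₂ F₀ m)))
      where
      ring : ∀ u w p q r f m → + 2 * u + w - (r - p) + + 2 * (u + w - (f - (p + q + r))) +
          (+ 2 * f + + 2 * m - + 3 * (p + q + r + r))
             ≡ + 4 * u + + 3 * w - (+ 5 * r + q - + 2 * m)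
      ring = solve-∀

    φ₁≥0 : 0ℤ ≤ value (φ₁ Q)
    φ₁≥0 = subst (0ℤ ≤_) (sym (value-φ₁ Q))
      (((scale 5 x₂-bad and i≤j⇒0≤j-i margin gives refl) and x-nonneg Q parts gives refl) and +≤+
          ℕ.z≤n
       gives ring x₂ (x Q parts) m t)
      where
      ring : ∀ r q m t → + 5 * (r - t) + (+ 5 * t - (+ 2 * m + 1ℤ)) + q + 1ℤ ≡ + 5 * r + q - + 2 * m
      ring = solve-∀

    φ₂≥0 : 0ℤ ≤ value (φ₂ P)
    φ₂≥0 = subst (0ℤ ≤_) (sym (value-φ₂ P)) (i≤j⇒0≤j-i (worst P))

    φ₃≥0 : 0ℤ ≤ value (φ₃ P)
    φ₃≥0 = subst (0ℤ ≤_) (sym (value-φ₃ P)) (≤-trans (+≤+ ℕ.z≤n) (others-good ext′ side))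

    module _ {num : ℕ} (enough : + num ≤ count k) where

      monotone : ∀ φ → 0ℤ ≤ value φ → + num * value φ ≤ count k * value φ
      monotone φ φ≥0 = *-monoʳ-≤-nonNeg (value φ) {{nonNegative φ≥0}} enough

      g₁-holds : Holds (vertexForm k g₁ num (φ₁ Q))
      g₁-holds = vertexForm-holds k g₁ num (φ₁ Q) g₁-bound (monotone (φ₁ Q) φ₁≥0)

      g₂-holds : Holds (vertexForm k g₂ num (φ₂ P))
      g₂-holds = vertexForm-holds k g₂ num (φ₂ P)
        (λ v eq → subst₂ _≤_ (sym (value-φ₂ P)) (sym (at-g₂ v)) (proj₂ (expensive v eq)))
            (monotone (φ₂ P) φ₂≥0)

      β-holds : Holds (vertexForm k β num (φ₃ P))
      β-holds = vertexForm-holds k β num (φ₃ P)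
        (λ v eq → subst (_≤ u v) (sym (value-φ₃ P)) (proj₁ (expensive v eq))) (monotone (φ₃ P) φ₃≥0)

    -- The bound F₀ - F is never positive, so a lower estimate of the number of heavy vertices would
    -- not do; it has to be exact.
    g₀-holds : ∀ {num} → + num ≡ count k → Holds (vertexForm k g₀ num φ₀)
    g₀-holds {num} exact = vertexForm-holds k g₀ num φ₀
      (λ v eq → subst₂ _≤_ (sym value-φ₀) (sym (at-g₀ v)) (stable v eq))
          (≤-reflexive (cong (_* value φ₀) exact))

  exceeds-holds : Holds exceeds
  exceeds-holds = subst (0ℤ ≤_) (sym (trans (cong (_+ (+ 5 * t + 0ℤ * F₀ + -1ℤ))
      (∑-* E (- + 2) (λ _ → 1ℤ))) (ring m t F₀)))
    (i≤j⇒0≤j-i margin)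
    where
    ring : ∀ m t F → - + 2 * m + (+ 5 * t + 0ℤ * F + -1ℤ) ≡ + 5 * t - (+ 2 * m + 1ℤ)
    ring = solve-∀

  attains-holds : Holds attains
  attains-holds = subst (0ℤ ≤_) (sym (ring x₂ t F₀)) x₂-bad
    where
    ring : ∀ r t F → r + (-1ℤ * t + 0ℤ * F + 0ℤ) ≡ r - t
    ring = solve-∀

  core-holds : ∀ {k l} → + k ≤ count a → + l ≤ count b → All Holds (core k l)
  core-holds k≤ l≤ =
    exceeds-holds ∷ attains-holds ∷ light-holds A-light ∷ light-holds B-light ∷
    HA.g₁-holds k≤ ∷ HA.g₂-holds k≤ ∷ HA.β-holds k≤ ∷ HB.g₁-holds l≤ ∷ HB.g₂-holds l≤ ∷ HB.β-holds
        l≤ ∷ []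
    where
    module HA = HeavyForms a-heavy
    module HB = HeavyForms b-heavy

  Φ-form-holds : Holds (form (λ x y z → + 2 - + 3 * (totalMissed x y z + missed 2F x y z)) 0ℤ (+ 2)
      0ℤ)
  Φ-form-holds = subst (0ℤ ≤_) (sym eq) (i≤j⇒0≤j-i Φ-bound)
    where
    pw : ∀ p q → + 2 - + 3 * (p + q) ≡ + 2 * 1ℤ + - + 3 * (1ℤ * p + 1ℤ * q)
    pw = solve-∀
    ring : ∀ m f r t F → + 2 * m + - + 3 * (1ℤ * f + 1ℤ * r) + (0ℤ * t + + 2 * F + 0ℤ) ≡ + 2 * F + +
        2 * m - + 3 * (f + r)
    ring = solve-∀
    eq : ⟨_∣_⟩ E (λ x y z → + 2 - + 3 * (totalMissed x y z + missed 2F x y z)) cls +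
        (0ℤ * t + + 2 * F₀ + 0ℤ)
         ≡ + 2 * F₀ + + 2 * m - + 3 * Φ parts
    eq = trans (cong (_+ (0ℤ * t + + 2 * F₀ + 0ℤ)) (trans (∑-cong E λ (_ , e) → let open Triple e in
             pw (totalMissed (cls p) (cls q) (cls r)) (missed 2F (cls p) (cls q) (cls r)))
           (trans (∑-linear E (+ 2) (- + 3) (λ _ → 1ℤ)
               (λ e → 1ℤ * on totalMissed cls e + 1ℤ * on (missed 2F) cls e))
             (cong (λ s → + 2 * m + - + 3 * s)
                 (∑-linear E 1ℤ 1ℤ (on totalMissed cls) (on (missed 2F) cls))))))
         (trans (ring m (F parts) x₂ t F₀) (cong (λ s → + 2 * F₀ + + 2 * m - + 3 * (F parts + s))
             (sym (top≡ ext′))))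

  F-form-holds : Holds (form totalMissed 0ℤ -1ℤ 0ℤ)
  F-form-holds = subst (0ℤ ≤_) (sym (ring (F parts) t F₀)) (i≤j⇒0≤j-i (F-min parts))
    where
    ring : ∀ f t F → f + (0ℤ * t + -1ℤ * F + 0ℤ) ≡ f - F
    ring = solve-∀

-- Few distinct edges are spanned by few heavy vertices

pigeonhole : {X : Set} {xs ys : List X} → Unique xs → (∀ {x} → x ∈ xs → x ∈ ys) →
    length xs ℕ.≤ length ys
pigeonhole []           xs⊆ys = ℕ.z≤n
pigeonhole {xs = x ∷ xs} (x∉xs ∷ xs!) xs⊆ys with ∈-∃++ (xs⊆ys (here refl))
... | zs , ws , refl = subst (suc (length xs) ℕ.≤_)
    (sym (trans (length-++ zs) (trans (ℕ.+-suc _ _) (cong suc (sym (length-++ zs))))))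
                             (ℕ.s≤s (pigeonhole xs! rest))
  where
  rest : ∀ {y} → y ∈ xs → y ∈ zs ++ ws
  rest y∈xs with ∈-++⁻ zs (xs⊆ys (there y∈xs))
  ... | inj₁ y∈zs         = ∈-++⁺ˡ y∈zs
  ... | inj₂ (here refl)  = contradiction refl (All.lookup x∉xs y∈xs)
  ... | inj₂ (there y∈ws) = ∈-++⁺ʳ zs y∈ws

∑-indicator : {X : Set} {P : X → Set} (P? : ∀ x → Dec (P x)) (xs : List X) →
              ∑ xs (λ v → does (P? v) ⊳ 1ℤ) ≡ + length (filter P? xs)
∑-indicator P? []       = refl
∑-indicator P? (x ∷ xs) with does (P? x)
... | true  = cong (λ s → 1ℤ + s) (∑-indicator P? xs)
... | false = trans (+-identityˡ _) (∑-indicator P? xs)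

tick : {P : Set} → Dec P → ℕ
tick d = if does d then 1 else 0

length-filter-∷ : {X : Set} {P : X → Set} (P? : ∀ x → Dec (P x)) (x : X) (xs : List X) →
                  length (filter P? (x ∷ xs)) ≡ tick (P? x) ℕ.+ length (filter P? xs)
length-filter-∷ P? x xs with does (P? x)
... | true  = refl
... | false = refl

length-filter₃ : {X : Set} {P : X → Set} (P? : ∀ x → Dec (P x)) (x y z : X) →
                 length (filter P? (x ∷ y ∷ z ∷ [])) ≡ tick (P? x) ℕ.+ (tick (P? y) ℕ.+ tick (P? z))
length-filter₃ P? x y z = trans (length-filter-∷ P? x (y ∷ z ∷ [])) (cong (tick (P? x) ℕ.+_)
  (trans (length-filter-∷ P? y (z ∷ [])) (cong (tick (P? y) ℕ.+_)
    (trans (length-filter-∷ P? z []) (ℕ.+-identityʳ _)))))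

pairs : {X : Set} → List X → List (X × X)
pairs []       = []
pairs (x ∷ xs) = map (x ,_) xs ++ pairs xs

length-pairs : {X : Set} (xs : List X) → length (pairs xs) ≡ choose₂ (length xs)
length-pairs []       = refl
length-pairs (x ∷ xs) = trans (length-++ (map (x ,_) xs))
    (cong₂ ℕ._+_ (length-map (x ,_) xs) (length-pairs xs))

∈-pairs : {X : Set} {xs : List X} {x y : X} → x ≢ y → x ∈ xs → y ∈ xs →
    (x , y) ∈ pairs xs ⊎ (y , x) ∈ pairs xs
∈-pairs x≢y (here refl) (here refl) = contradiction refl x≢y
∈-pairs x≢y (here refl) (there y∈)  = inj₁ (∈-++⁺ˡ (∈-map⁺ _ y∈))
∈-pairs x≢y (there x∈)  (here refl) = inj₂ (∈-++⁺ˡ (∈-map⁺ _ x∈))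
∈-pairs {xs = w ∷ xs} x≢y (there x∈) (there y∈) with ∈-pairs x≢y x∈ y∈
... | inj₁ xy∈ = inj₁ (∈-++⁺ʳ (map (w ,_) xs) xy∈)
... | inj₂ yx∈ = inj₂ (∈-++⁺ʳ (map (w ,_) xs) yx∈)

-- Disjointness of the two classes forces the single vertex of the second class to be the one
-- outside the first.
two-one : {K L : Set} {K′ L′ : Set} {K″ L″ : Set} → (K → ¬ L) → (K′ → ¬ L′) → (K″ → ¬ L″) →
          (k : Dec K) (k′ : Dec K′) (k″ : Dec K″) (l : Dec L) (l′ : Dec L′) (l″ : Dec L″) →
          T ((tick k ℕ.+ (tick k′ ℕ.+ tick k″) ≡ᵇ 2) ∧ (tick l ℕ.+ (tick l′ ℕ.+ tick l″) ≡ᵇ 1)) →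
          (K × K′ × L″) ⊎ (K × K″ × L′) ⊎ (K′ × K″ × L)
two-one e e′ e″ (yes k) (yes k′) (no _)   _       _        (yes l″) _ = inj₁ (k , k′ , l″)
two-one e e′ e″ (yes k) (yes k′) (no _)   (yes l) _        (no _)   _ = ⊥-elim (e k l)
two-one e e′ e″ (yes k) (yes k′) (no _)   (no _)  (yes l′) (no _)   _ = ⊥-elim (e′ k′ l′)
two-one e e′ e″ (yes k) (no _)   (yes k″) _       (yes l′) _        _ = inj₂ (inj₁ (k , k″ , l′))
two-one e e′ e″ (yes k) (no _)   (yes k″) (yes l) (no _)   _        _ = ⊥-elim (e k l)
two-one e e′ e″ (yes k) (no _)   (yes k″) (no _)  (no _)   (yes l″) _ = ⊥-elim (e″ k″ l″)
two-one e e′ e″ (no _)  (yes k′) (yes k″) (yes l) _        _        _ = inj₂ (inj₂ (k′ , k″ , l))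
two-one e e′ e″ (no _)  (yes k′) (yes k″) (no _)  (yes l′) _        _ = ⊥-elim (e′ k′ l′)
two-one e e′ e″ (no _)  (yes k′) (yes k″) (no _)  (no _)   (yes l″) _ = ⊥-elim (e″ k″ l″)
two-one e e′ e″ (yes _) (yes _)  (no _)   (no _)  (no _)   (no _)   ()
two-one e e′ e″ (yes _) (no _)   (yes _)  (no _)  (no _)   (no _)   ()
two-one e e′ e″ (no _)  (yes _)  (yes _)  (no _)  (no _)   (no _)   ()
two-one e e′ e″ (yes _) (yes _)  (yes _)  _       _        _        ()
two-one e e′ e″ (yes _) (no _)   (no _)   _       _        _        ()
two-one e e′ e″ (no _)  (yes _)  (no _)   _       _        _        ()
two-one e e′ e″ (no _)  (no _)   (yes _)  _       _        _        ()
two-one e e′ e″ (no _)  (no _)   (no _)   _       _        _        ()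

trio : ∀ {n} → Fin n → Fin n → Fin n → Subset n
trio x y z = ⁅ x ⁆ ∪ (⁅ y ⁆ ∪ ⁅ z ⁆)

∈-trio⁻ : ∀ {n} (x y z : Fin n) {v} → v ∈ₛ trio x y z → v ≡ x ⊎ v ≡ y ⊎ v ≡ z
∈-trio⁻ x y z v∈ with x∈p∪q⁻ ⁅ x ⁆ _ v∈
... | inj₁ v∈x = inj₁ (x∈⁅y⁆⇒x≡y x v∈x)
... | inj₂ v∈yz with x∈p∪q⁻ ⁅ y ⁆ _ v∈yz
...   | inj₁ v∈y = inj₂ (inj₁ (x∈⁅y⁆⇒x≡y y v∈y))
...   | inj₂ v∈z = inj₂ (inj₂ (x∈⁅y⁆⇒x≡y z v∈z))

trio≡ : ∀ {n} {s : Subset n} {x y z} → x ∈ₛ s → y ∈ₛ s → z ∈ₛ s →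
        (∀ {v} → v ∈ₛ s → v ≡ x ⊎ v ≡ y ⊎ v ≡ z) → s ≡ trio x y z
trio≡ {s = s} {x} {y} {z} x∈ y∈ z∈ cover = ⊆-antisym into onto
  where
  into : ∀ {v} → v ∈ₛ s → v ∈ₛ trio x y z
  into v∈ with cover v∈
  ... | inj₁ refl        = x∈p∪q⁺ (inj₁ (x∈⁅x⁆ x))
  ... | inj₂ (inj₁ refl) = x∈p∪q⁺ (inj₂ (x∈p∪q⁺ (inj₁ (x∈⁅x⁆ y))))
  ... | inj₂ (inj₂ refl) = x∈p∪q⁺ (inj₂ (x∈p∪q⁺ (inj₂ (x∈⁅x⁆ z))))
  onto : ∀ {v} → v ∈ₛ trio x y z → v ∈ₛ s
  onto v∈ with ∈-trio⁻ x y z v∈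
  ... | inj₁ refl        = x∈
  ... | inj₂ (inj₁ refl) = y∈
  ... | inj₂ (inj₂ refl) = z∈

length-product : {X Y Z : Set} (f : X → Y → Z) (xs : List X) (ys : List Y) →
                 length (cartesianProductWith f xs ys) ≡ length xs ℕ.* length ys
length-product f []       ys = refl
length-product f (x ∷ xs) ys = trans (length-++ (map (f x) ys))
    (cong₂ ℕ._+_ (length-map (f x) ys) (length-product f xs ys))

module Sparse {n} (E : List (Edge n)) (E! : Unique (map proj₁ E)) (cls : Fin n → Class) (t F₀ : ℤ)
    where

  open Counting E cls t F₀

  members : Class → List (Fin n)
  members k = filter (λ v → cls v ≟ᶜ k) (allFin n)

  count≡ : ∀ k → count k ≡ + length (members k)
  count≡ k = ∑-indicator (λ v → cls v ≟ᶜ k) (allFin n)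

  ∈-members : ∀ {k v} → cls v ≡ k → v ∈ members k
  ∈-members {k} = ∈-filter⁺ (λ v → cls v ≟ᶜ k) (∈-allFin _)

  multiplicity≤ : ∀ k (e : Edge n) → let open Triple (proj₂ e) in
                  multiplicity k (cls p) (cls q) (cls r) ℕ.≤ length (members k)
  multiplicity≤ k (_ , e) = subst (ℕ._≤ length (members k))
      (length-filter₃ (λ v → cls v ≟ᶜ k) p q r)
    (pigeonhole (Unique.filter⁺ (λ v → cls v ≟ᶜ k) ((p≢q ∷ p≢r ∷ []) ∷ (q≢r ∷ []) ∷ [] ∷ []))
                (λ v∈ → ∈-members (proj₂ (∈-filter⁻ (λ v → cls v ≟ᶜ k) {xs = p ∷ q ∷ r ∷ []} v∈))))
    where open Triple e

  few-holds : ∀ k {num} → length (members k) ℕ.≤ num → Holds (few k num)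
  few-holds k {num} bound = subst (λ s → 0ℤ ≤ s + (0ℤ * t + 0ℤ * F₀ + 0ℤ))
    (sym (trans (∑-cong E λ e → vanish (ℕ.≤-trans (multiplicity≤ k e) bound)) (∑-zero E)))
        (≤-reflexive (sym (ring t F₀)))
    where
    ring : ∀ t F → 0ℤ + (0ℤ * t + 0ℤ * F + 0ℤ) ≡ 0ℤ
    ring = solve-∀
    vanish : ∀ {i} → i ℕ.≤ num → (if num <ᵇ i then -1ℤ else 0ℤ) ≡ 0ℤ
    vanish {i} i≤ with num <ᵇ i in eq
    ... | false = refl
    ... | true  = contradiction (ℕ.<ᵇ⇒< num i (subst T (sym eq) _)) (ℕ.≤⇒≯ i≤)

  candidates : Class → Class → List (Subset n)
  candidates k l = cartesianProductWith (λ (x , y) z → trio x y z) (pairs (members k)) (members l)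

  candidate : ∀ {k l s x y z} → x ≢ y → cls x ≡ k → cls y ≡ k → cls z ≡ l → x ∈ₛ s → y ∈ₛ s →
      z ∈ₛ s →
              (∀ {v} → v ∈ₛ s → v ≡ x ⊎ v ≡ y ⊎ v ≡ z) → s ∈ candidates k l
  candidate {k} {l} {s} {x} {y} {z} x≢y xk yk zl x∈ y∈ z∈ cover with ∈-pairs x≢y (∈-members xk)
      (∈-members yk)
  ... | inj₁ xy∈ = subst (_∈ candidates k l) (sym (trio≡ x∈ y∈ z∈ cover))
      (∈-cartesianProductWith⁺ _ xy∈ (∈-members zl))
  ... | inj₂ yx∈ = subst (_∈ candidates k l) (sym (trio≡ y∈ x∈ z∈ (λ v∈ → swap (cover v∈))))
      (∈-cartesianProductWith⁺ _ yx∈ (∈-members zl))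
    where
    swap : ∀ {X Y Z : Set} → X ⊎ Y ⊎ Z → Y ⊎ X ⊎ Z
    swap (inj₁ x)        = inj₂ (inj₁ x)
    swap (inj₂ (inj₁ y)) = inj₁ y
    swap (inj₂ (inj₂ z)) = inj₂ (inj₂ z)

  pattern? : Class → Class → Edge n → Bool
  pattern? k l (_ , e) = (multiplicity k (cls p) (cls q) (cls r) ≡ᵇ 2) ∧
      (multiplicity l (cls p) (cls q) (cls r) ≡ᵇ 1)
    where open Triple e

  pattern-candidate : ∀ {k l} → k ≢ l → ∀ e → T (pattern? k l e) → proj₁ e ∈ candidates k l
  pattern-candidate {k} {l} k≢l (_ , e) ok with two-one excl excl excl
      (cls p ≟ᶜ k) (cls q ≟ᶜ k) (cls r ≟ᶜ k) (cls p ≟ᶜ l) (cls q ≟ᶜ l) (cls r ≟ᶜ l) ok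
    where
    open Triple e
    excl : ∀ {v} → cls v ≡ k → ¬ (cls v ≡ l)
    excl vk vl = k≢l (trans (sym vk) vl)
  ... | inj₁ (pk , qk , rl)        = candidate p≢q pk qk rl p∈s q∈s r∈s cover where open Triple e
  ... | inj₂ (inj₁ (pk , rk , ql)) = candidate p≢r pk rk ql p∈s r∈s q∈s (perm ∘ cover)
    where
    open Triple e
    perm : ∀ {X Y Z : Set} → X ⊎ Y ⊎ Z → X ⊎ Z ⊎ Y
    perm (inj₁ x)        = inj₁ x
    perm (inj₂ (inj₁ y)) = inj₂ (inj₂ y)
    perm (inj₂ (inj₂ z)) = inj₂ (inj₁ z)
  ... | inj₂ (inj₂ (qk , rk , pl)) = candidate q≢r qk rk pl q∈s r∈s p∈s (perm ∘ cover)
    where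
    open Triple e
    perm : ∀ {X Y Z : Set} → X ⊎ Y ⊎ Z → Y ⊎ Z ⊎ X
    perm (inj₁ x)        = inj₂ (inj₂ x)
    perm (inj₂ (inj₁ y)) = inj₁ y
    perm (inj₂ (inj₂ z)) = inj₂ (inj₁ z)

  ∑-penalty : ∀ (es : List (Edge n)) h → ∑ es (λ e → if h e then -1ℤ else 0ℤ) ≡ - + length
      (filterᵇ h es)
  ∑-penalty []       h = refl
  ∑-penalty (e ∷ es) h with h e
  ... | false = trans (+-identityˡ _) (∑-penalty es h)
  ... | true  = trans (cong (λ s → -1ℤ + s) (∑-penalty es h))
      (sym (ℤ.neg-distrib-+ 1ℤ (+ length (filterᵇ h es))))

  -- An edge of this pattern is determined by an unordered pair from class k and a vertex of class
  -- l. As the edges are distinct subsets, there are at most as many as there are `candidates`.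
  mixed-holds : ∀ {k l} → k ≢ l → ∀ {i j} → length (members k) ≡ i → length (members l) ≡ j →
                Holds (mixed k l (choose₂ i ℕ.* j))
  mixed-holds {k} {l} k≢l refl refl = subst (0ℤ ≤_) (sym value≡) (i≤j⇒0≤j-i (+≤+ bound))
    where
    N : ℕ
    N = choose₂ (length (members k)) ℕ.* length (members l)
    hits : List (Edge n)
    hits = filterᵇ (pattern? k l) E
    hits! : Unique (map proj₁ hits)
    hits! = AllPairs.map⁺ (AllPairs.filter⁺ (T? ∘ pattern? k l) (AllPairs.map⁻ E!))
    bound : length hits ℕ.≤ choose₂ (length (members k)) ℕ.* length (members l)
    bound = subst₂ ℕ._≤_ (length-map proj₁ hits)
      (trans (length-product _ (pairs (members k)) (members l))
          (cong (ℕ._* length (members l)) (length-pairs (members k))))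
      (pigeonhole hits! λ s∈ → let (e , e∈ , eq) = ∈-map⁻ proj₁ s∈ in
        subst (_∈ candidates k l) (sym eq) (pattern-candidate k≢l e
            (proj₂ (∈-filter⁻ (T? ∘ pattern? k l) {xs = E} e∈))))
    ring : ∀ h t F c → - h + (0ℤ * t + 0ℤ * F + c) ≡ c - h
    ring = solve-∀
    value≡ : value (mixed k l (choose₂ (length (members k)) ℕ.* length (members l)))
             ≡ + (choose₂ (length (members k)) ℕ.* length (members l)) - + length hits
    value≡ = trans (cong (_+ (0ℤ * t + 0ℤ * F₀ + + N)) (∑-penalty E (pattern? k l)))
        (ring (+ length hits) t F₀ (+ N))

-- Exchanging a heavy vertex for a vertex of the worst part

data Label : Set where
  first second chosen : Label
  other               : Class → Label

labels : List Label
labels = first ∷ second ∷ chosen ∷ map other classes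

label∈ : ∀ x → x ∈ labels
label∈ first     = here refl
label∈ second    = there (here refl)
label∈ chosen    = there (there (here refl))
label∈ (other c) = there (there (there (∈-map⁺ other (class∈ c))))

code : Label → ℕ
code first     = 0
code second    = 1
code chosen    = 2
code (other c) = 3 ℕ.+ rank c

labelClass : Class → Label → Class
labelClass k first     = k
labelClass k second    = k
labelClass k chosen    = C
labelClass k (other c) = c

-- Let P have exactly two heavy vertices.  If some edge missing P has two vertices in 2F, one of them,
-- the chosen vertex, is moved to P, and in return either heavy vertex is moved to 2F.  Adding the two
-- conditions F₀ ≤ F for the resulting colourings makes the effects on the remaining edges cancel.
exchanged₁ exchanged₂ : Fin 3 → Class → Label → Fin 3
exchanged₁ P k first  = 2F
exchanged₁ P k chosen = P
exchanged₁ P k x      = colour (labelClass k x)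
exchanged₂ P k second = 2F
exchanged₂ P k chosen = P
exchanged₂ P k x      = colour (labelClass k x)

repeated : Label → Label → Bool
repeated x y = (code x <ᵇ 3) ∧ (code x ≡ᵇ code y)

spurious : Class → Label → Bool
spurious k (other c) = does (c ≟ᶜ k)
spurious k _         = false

-- On three distinct vertices a special label occurs at most once, and `other k` does not occur
-- because `first` and `second` are the only vertices of class k. The evaluation is confined to the
-- remaining label triples.
illegal : Class → Label → Label → Label → Bool
illegal k x y z = repeated x y ∨ repeated x z ∨ repeated y z ∨ spurious k x ∨ spurious k y ∨
    spurious k z

isChosen : Label → Bool
isChosen x = code x ≡ᵇ 2

untouchedᵇ : Fin 3 → Class → Class → Class → Bool
untouchedᵇ P x y z = (multiplicityᶠ P x y z ≡ᵇ 0) ∧ (1 <ᵇ multiplicityᶠ 2F x y z)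

witness : Fin 3 → Class → Label → Label → Label → Bool
witness P k x y z = (isChosen x ∨ isChosen y ∨ isChosen z) ∧ untouchedᵇ P (labelClass k x)
    (labelClass k y) (labelClass k z)

data Exchange : Fin 3 → Class → Class → Set where
  A-exchange : Exchange 0F A a
  B-exchange : Exchange 1F B b

heavy≢C : ∀ {P l k} → Exchange P l k → k ≢ C
heavy≢C A-exchange ()
heavy≢C B-exchange ()

lower : Fin 3 → Class → Label → Label → Label → ℤ
lower P k x y z = total (exchanged₁ P k x) (exchanged₁ P k y) (exchanged₁ P k z)
                + total (exchanged₂ P k x) (exchanged₂ P k y) (exchanged₂ P k z)
                + + 2 * (witness P k x y z ⊳ 1ℤ)

upper : Fin 3 → Class → Class → Label → Label → Label → ℤ
upper P l k x y z = Form.density (exchange P l k) (labelClass k x) (labelClass k y) (labelClass k z)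

exchange-check : Fin 3 → Class → Class → Label → Label → Label → Bool
exchange-check P l k x y z = illegal k x y z ∨ (lower P k x y z ≤ᵇ upper P l k x y z)

exchange-pointwise : ∀ {P l k} → Exchange P l k → ∀ x y z → illegal k x y z ≡ false →
    lower P k x y z ≤ upper P l k x y z
exchange-pointwise {P} {l} {k} ex x y z legal =
    ≤ᵇ⇒≤ (subst (λ i → T (i ∨ (lower P k x y z ≤ᵇ upper P l k x y z))) legal (checked ex))
  where
  checked : Exchange P l k → T (exchange-check P l k x y z)
  checked A-exchange = ∀³-sound labels (exchange-check 0F A a) tt (label∈ x) (label∈ y) (label∈ z)
  checked B-exchange = ∀³-sound labels (exchange-check 1F B b) tt (label∈ x) (label∈ y) (label∈ z)

colour≡2F : ∀ x → colour x ≡ 2F → x ≡ C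
colour≡2F C refl = refl

∑-witness : {X : Set} {xs : List X} {f : X → ℤ} {x : X} → (∀ y → 0ℤ ≤ f y) → x ∈ xs → f x ≡ 1ℤ →
    1ℤ ≤ ∑ xs f
∑-witness {xs = _ ∷ xs} {f} 0≤f (here refl) fx≡1 = +-mono-≤ (≤-reflexive (sym fx≡1)) (∑-≥0 xs 0≤f)
∑-witness {f = f}           0≤f (there x∈)  fx≡1 = +-mono-≤ (0≤f _) (∑-witness 0≤f x∈ fx≡1)

⊳-nonneg : ∀ c → 0ℤ ≤ c ⊳ 1ℤ
⊳-nonneg true  = +≤+ ℕ.z≤n
⊳-nonneg false = ≤-refl

module Exchanging {n} (E : List (Edge n)) (E! : Unique (map proj₁ E)) (cls : Fin n → Class)
    (t F₀ : ℤ)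
                  (F-min : ∀ d → F₀ ≤ Partition.F E d) where

  open Counting E cls t F₀
  open Sparse E E! cls t F₀ using (members; ∈-members)
  open Partition E using (⟨⟩-cong)

  module _ {P l k} (ex : Exchange P l k) {x₁ x₂ : Fin n} (members≡ : members k ≡ x₁ ∷ x₂ ∷ [])
           (k₁ : cls x₁ ≡ k) (k₂ : cls x₂ ≡ k) {z : Fin n} (zC : cls z ≡ C) where

    label : Fin n → Label
    label v = if does (v ≟ x₁) then first else if does (v ≟ x₂) then second
              else if does (v ≟ z) then chosen else other (cls v)

    data View (v : Fin n) : Label → Set where
      is-first  : v ≡ x₁ → View v first
      is-second : v ≡ x₂ → View v second
      is-chosen : v ≡ z → View v chosen
      is-other  : v ≢ z → cls v ≢ k → View v (other (cls v))

    view : ∀ v → View v (label v)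
    view v with v ≟ x₁ | v ≟ x₂ | v ≟ z
    ... | yes v≡x₁ | _        | _       = is-first v≡x₁
    ... | no _     | yes v≡x₂ | _       = is-second v≡x₂
    ... | no _     | no _     | yes v≡z = is-chosen v≡z
    ... | no v≢x₁  | no v≢x₂  | no v≢z  = is-other v≢z λ vk →
        absent (subst (v ∈_) members≡ (∈-members vk))
      where
      absent : ¬ (v ∈ x₁ ∷ x₂ ∷ [])
      absent (here v≡x₁)         = v≢x₁ v≡x₁
      absent (there (here v≡x₂)) = v≢x₂ v≡x₂

    label-class : ∀ v → labelClass k (label v) ≡ cls v
    label-class v with label v | view v
    ... | _ | is-first refl  = sym k₁
    ... | _ | is-second refl = sym k₂
    ... | _ | is-chosen refl = sym zC
    ... | _ | is-other _ _   = refl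

    not-repeated : ∀ {u v} → u ≢ v → repeated (label u) (label v) ≡ false
    not-repeated {u} {v} u≢v with label u | view u | label v | view v
    ... | _ | is-first refl  | _ | is-first refl  = contradiction refl u≢v
    ... | _ | is-first _     | _ | is-second _    = refl
    ... | _ | is-first _     | _ | is-chosen _    = refl
    ... | _ | is-first _     | _ | is-other _ _   = refl
    ... | _ | is-second _    | _ | is-first _     = refl
    ... | _ | is-second refl | _ | is-second refl = contradiction refl u≢v
    ... | _ | is-second _    | _ | is-chosen _    = refl
    ... | _ | is-second _    | _ | is-other _ _   = refl
    ... | _ | is-chosen _    | _ | is-first _     = refl
    ... | _ | is-chosen _    | _ | is-second _    = refl
    ... | _ | is-chosen refl | _ | is-chosen refl = contradiction refl u≢v
    ... | _ | is-chosen _    | _ | is-other _ _   = refl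
    ... | _ | is-other _ _   | _ | _              = refl

    not-spurious : ∀ v → spurious k (label v) ≡ false
    not-spurious v with label v | view v
    ... | _ | is-first _     = refl
    ... | _ | is-second _    = refl
    ... | _ | is-chosen _    = refl
    ... | _ | is-other _ cls≢k = dec-no (cls v ≟ᶜ k) cls≢k
      where
      dec-no : ∀ {X : Set} (d : Dec X) → ¬ X → does d ≡ false
      dec-no (yes x) ¬x = contradiction x ¬x
      dec-no (no _)  _  = refl

    legal : ∀ (e : Edge n) → let open Triple (proj₂ e) in illegal k (label p) (label q) (label r) ≡
        false
    legal (_ , e) rewrite not-repeated (Triple.p≢q e) | not-repeated (Triple.p≢r e) | not-repeated
        (Triple.q≢r e)
      | not-spurious (Triple.p e) | not-spurious (Triple.q e) | not-spurious (Triple.r e) = refl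

    label-z : label z ≡ chosen
    label-z with label z | view z
    ... | _ | is-first refl   = contradiction (trans (sym k₁) zC) (heavy≢C ex)
    ... | _ | is-second refl  = contradiction (trans (sym k₂) zC) (heavy≢C ex)
    ... | _ | is-chosen _     = refl
    ... | _ | is-other z≢z _  = contradiction refl z≢z

    witness-at : Edge n → ℤ
    witness-at (_ , e) = witness P k (label p) (label q) (label r) ⊳ 1ℤ
      where open Triple e

    witness-nonneg : ∀ e → 0ℤ ≤ witness-at e
    witness-nonneg (_ , e) = ⊳-nonneg (witness P k (label p) (label q) (label r))
      where open Triple e

    exchange-holds : ∀ {e} → e ∈ E → witness-at e ≡ 1ℤ → Holds (exchange P l k)
    exchange-holds e∈ hit = (i≤j⇒0≤j-i sum-bound and scale 2
        (i≤j⇒0≤j-i (∑-witness witness-nonneg e∈ hit)) gives refl)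
      and (i≤j⇒0≤j-i (F-min c₁) and i≤j⇒0≤j-i (F-min c₂) gives refl) gives ring
          (⟨_∣_⟩ E (Form.density (exchange P l k)) cls) (F c₁) (F c₂) (∑ E witness-at) t F₀
      where
      open Partition E using (F)
      c₁ c₂ : Fin n → Fin 3
      c₁ = exchanged₁ P k ∘ label
      c₂ = exchanged₂ P k ∘ label
      sum-bound : F c₁ + F c₂ + + 2 * ∑ E witness-at ≤ ⟨_∣_⟩ E (Form.density (exchange P l k)) cls
      sum-bound = subst₂ _≤_
        (trans (∑-+ E (λ e → on total c₁ e + on total c₂ e) (λ e → + 2 * witness-at e))
          (cong₂ _+_ (∑-+ E (on total c₁) (on total c₂)) (∑-* E (+ 2) witness-at)))
        (⟨⟩-cong (Form.density (exchange P l k)) label-class)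
        (∑-mono E λ e′@(_ , e) → let open Triple e in exchange-pointwise ex (label p) (label q)
            (label r) (legal e′))
      ring : ∀ s f g w t F → (s - (f + g + + 2 * w)) + + 2 * (w - 1ℤ) + ((f - F) + (g - F)) ≡ s +
          (0ℤ * t + - + 2 * F + - + 2)
      ring = solve-∀

  -- Any `untouched` edge supplies the chosen vertex and is itself the edge that improves in both
  -- colourings.
  barren-or-exchange : ∀ {P l k} → Exchange P l k → length (members k) ≡ 2 →
      Holds (barren P) ⊎ Holds (exchange P l k)
  barren-or-exchange {P} {l} {k} ex two with any? (λ e → T? (on-bool e)) E
    where
    on-bool : Edge n → Bool
    on-bool (_ , e) = untouchedᵇ P (cls p) (cls q) (cls r)
      where open Triple e
  ... | no none = inj₁ (subst (λ s → 0ℤ ≤ s + (0ℤ * t + 0ℤ * F₀ + 0ℤ))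
      (sym (vanish (¬Any⇒All¬ E none))) (≤-reflexive (sym (ring t F₀))))
    where
    ring : ∀ t F → 0ℤ + (0ℤ * t + 0ℤ * F + 0ℤ) ≡ 0ℤ
    ring = solve-∀
    vanish : ∀ {es : List (Edge n)} → All (λ (_ , e) →
        let open Triple e in ¬ T (untouchedᵇ P (cls p) (cls q) (cls r))) es →
             ∑ es (on (λ x y z → - untouched P x y z) cls) ≡ 0ℤ
    vanish []         = refl
    vanish {(_ , e) ∷ _} (¬u ∷ ¬us) with untouchedᵇ P (cls (Triple.p e)) (cls (Triple.q e))
        (cls (Triple.r e))
    ... | true  = contradiction tt ¬u
    ... | false = trans (+-identityˡ _) (vanish ¬us)
  ... | yes some with find some
  ...   | (s , e) , e∈ , u = inj₂ (found (members k) refl two)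
    where
    open Triple e
    -- At least two of the three vertices lie in `2F`, hence one of the first two does.
    in-part-2 : cls p ≡ C ⊎ cls q ≡ C
    in-part-2 with colour (cls p) ≟ 2F | colour (cls q) ≟ 2F
    ... | yes pC | _      = inj₁ (colour≡2F _ pC)
    ... | no _   | yes qC = inj₂ (colour≡2F _ qC)
    ... | no p≢  | no q≢  = ⊥-elim (ℕ.<⇒≱ (ℕ.<ᵇ⇒< 1 _ (proj₂ (Equivalence.to T-∧ u)))
        (at-most-one p≢ q≢))
      where
      not-2F : ∀ {x} → x ≢ 2F → isFin 2F x ≡ 0
      not-2F {0F} _   = refl
      not-2F {1F} _   = refl
      not-2F {2F} x≢2 = contradiction refl x≢2
      isFin≤1 : ∀ x → isFin 2F x ℕ.≤ 1
      isFin≤1 0F = ℕ.z≤n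
      isFin≤1 1F = ℕ.z≤n
      isFin≤1 2F = ℕ.≤-refl
      at-most-one : colour (cls p) ≢ 2F → colour (cls q) ≢ 2F →
          multiplicityᶠ 2F (cls p) (cls q) (cls r) ℕ.≤ 1
      at-most-one p≢ q≢ rewrite not-2F p≢ | not-2F q≢ = isFin≤1 (colour (cls r))
    found : ∀ xs → members k ≡ xs → length xs ≡ 2 → Holds (exchange P l k)
    found (x₁ ∷ x₂ ∷ []) eq refl = pick in-part-2
      where
      k-member : ∀ {v} → v ∈ x₁ ∷ x₂ ∷ [] → cls v ≡ k
      k-member v∈ = proj₂ (∈-filter⁻ (λ v → cls v ≟ᶜ k) {xs = allFin n} (subst (_ ∈_) (sym eq) v∈))
      k₁ : cls x₁ ≡ k
      k₁ = k-member (here refl)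
      k₂ : cls x₂ ≡ k
      k₂ = k-member (there (here refl))
      T≡ : ∀ {b} → T b → b ⊳ 1ℤ ≡ 1ℤ
      T≡ {true} _ = refl
      middle : ∀ x {y} → T y → T ((x ∨ true) ∧ y)
      middle true  y = y
      middle false y = y
      pick : cls p ≡ C ⊎ cls q ≡ C → Holds (exchange P l k)
      pick (inj₁ pC) = exchange-holds ex eq k₁ k₂ pC e∈ (T≡ hit)
        where
        hit : T (witness P k (label ex eq k₁ k₂ pC p) (label ex eq k₁ k₂ pC q)
            (label ex eq k₁ k₂ pC r))
        hit rewrite label-class ex eq k₁ k₂ pC p | label-class ex eq k₁ k₂ pC q | label-class ex eq
            k₁ k₂ pC r | label-z ex eq k₁ k₂ pC = u
      pick (inj₂ qC) = exchange-holds ex eq k₁ k₂ qC e∈ (T≡ hit)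
        where
        hit : T (witness P k (label ex eq k₁ k₂ qC p) (label ex eq k₁ k₂ qC q)
            (label ex eq k₁ k₂ qC r))
        hit rewrite label-class ex eq k₁ k₂ qC p | label-class ex eq k₁ k₂ qC q | label-class ex eq
            k₁ k₂ qC r | label-z ex eq k₁ k₂ qC = middle (isChosen (label ex eq k₁ k₂ qC p)) u

-- The weights are rational solutions of the dual linear programs, scaled to integers; the splits
-- are branchings on integer quantities.

exactly-0-0 : Certificate
exactly-0-0 =
  weights (8 ∷ 20 ∷ 0 ∷ 0 ∷ 26 ∷ 130 ∷ 17 ∷ 20 ∷ 10 ∷ 0 ∷ 0 ∷ 10 ∷ [])

exactly-1-0 : Certificate
exactly-1-0 =
  weights (7 ∷ 20 ∷ 0 ∷ 0 ∷ 22 ∷ 110 ∷ 11 ∷ 14 ∷ 5 ∷ 0 ∷ 0 ∷ 6 ∷ [])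

exactly-1-1 : Certificate
exactly-1-1 =
  weights (2 ∷ 3 ∷ 1 ∷ 0 ∷ 2 ∷ 10 ∷ 2 ∷ 2 ∷ 0 ∷ 1 ∷ 0 ∷ 0 ∷ 1 ∷ [])

exactly-2-1 : Certificate
exactly-2-1 =
  weights (0 ∷ 7 ∷ 3 ∷ 0 ∷ 5 ∷ 25 ∷ 3 ∷ 4 ∷ 0 ∷ 3 ∷ 0 ∷ 0 ∷ 2 ∷ [])

exactly-3-1 : Certificate
exactly-3-1 =
  weights (0 ∷ 43 ∷ 9 ∷ 0 ∷ 38 ∷ 190 ∷ 15 ∷ 22 ∷ 3 ∷ 12 ∷ 0 ∷ 0 ∷ 11 ∷ [])

exactly-4-1 : Certificate
exactly-4-1 =
  weights (0 ∷ 29 ∷ 3 ∷ 0 ∷ 31 ∷ 155 ∷ 9 ∷ 14 ∷ 3 ∷ 6 ∷ 0 ∷ 0 ∷ 7 ∷ [])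

exactly-5-1 : Certificate
exactly-5-1 =
  weights (0 ∷ 73 ∷ 3 ∷ 0 ∷ 92 ∷ 460 ∷ 21 ∷ 34 ∷ 9 ∷ 12 ∷ 0 ∷ 0 ∷ 17 ∷ [])

exactly-5-2 : Certificate
exactly-5-2 =
  weights (0 ∷ 240 ∷ 0 ∷ 90 ∷ 630 ∷ 2196 ∷ 87 ∷ 132 ∷ 58 ∷ 0 ∷ 62 ∷ 8 ∷ 0 ∷ 322 ∷ [])

exactly-6-2 : Certificate
exactly-6-2 =
  weights (0 ∷ 88 ∷ 0 ∷ 22 ∷ 286 ∷ 1006 ∷ 36 ∷ 47 ∷ 24 ∷ 0 ∷ 20 ∷ 2 ∷ 0 ∷ 152 ∷ [])

exactly-7-2 : Certificate
exactly-7-2 =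
  weights (0 ∷ 288 ∷ 0 ∷ 36 ∷ 1116 ∷ 3954 ∷ 129 ∷ 147 ∷ 86 ∷ 0 ∷ 58 ∷ 2 ∷ 0 ∷ 610 ∷ [])

atLeast-2-0 : Certificate
atLeast-2-0 =
  weights (348 ∷ 546 ∷ 2170 ∷ 105 ∷ 252 ∷ 70 ∷ 0 ∷ 280 ∷ 110 ∷ [])

atLeast-6-1 : Certificate
atLeast-6-1 =
  weights (22 ∷ 32 ∷ 160 ∷ 6 ∷ 10 ∷ 3 ∷ 3 ∷ 0 ∷ 0 ∷ 5 ∷ [])

atLeast-8-2 : Certificate
atLeast-8-2 =
  weights (16 ∷ 72 ∷ 264 ∷ 8 ∷ 8 ∷ 5 ∷ 1 ∷ 2 ∷ 0 ∷ 0 ∷ 40 ∷ [])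

core-3-3 : Certificate
core-3-3 =
  weights (27 ∷ 93 ∷ 3 ∷ 3 ∷ 2 ∷ 0 ∷ 7 ∷ 2 ∷ 0 ∷ 7 ∷ [])

optimal-4-2 : Certificate
optimal-4-2 =
  split (missed 2F ≥ 7)
    (weights (16 ∷ 0 ∷ 0 ∷ 0 ∷ 0 ∷ 0 ∷ 74 ∷ 0 ∷ 45 ∷ 76 ∷ 324 ∷ 24 ∷ 40 ∷ 7 ∷ 14 ∷ 0 ∷ 0 ∷ 6 ∷ 28 ∷
               []))
    (weights (108 ∷ 0 ∷ 0 ∷ 0 ∷ 0 ∷ 0 ∷ 108 ∷ 0 ∷ 0 ∷ 702 ∷ 2406 ∷ 93 ∷ 93 ∷ 62 ∷ 0 ∷ 100 ∷ 26 ∷ 0 ∷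
               352 ∷ []))

optimal-3-2-barren : Certificate
optimal-3-2-barren =
  split (missed 2F ≥ 5)
    (weights (3 ∷ 7 ∷ 0 ∷ 0 ∷ 0 ∷ 0 ∷ 0 ∷ 16 ∷ 0 ∷ 9 ∷ 14 ∷ 50 ∷ 4 ∷ 8 ∷ 1 ∷ 4 ∷ 0 ∷ 0 ∷ 0 ∷ 10 ∷
               []))
    (weights (36 ∷ 24 ∷ 0 ∷ 0 ∷ 0 ∷ 0 ∷ 0 ∷ 24 ∷ 0 ∷ 0 ∷ 156 ∷ 498 ∷ 21 ∷ 21 ∷ 14 ∷ 0 ∷ 34 ∷ 6 ∷ 0 ∷
               90 ∷ []))

-- Upper bounds on the sums of α over the two heavy classes are lowered alternately, each being used
-- for the next, down to 9 for `a` and 10 for `b`. These give x₂ ≤ 6, and one last branching closes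
-- the case.
optimal-3-2-exchange : Certificate
optimal-3-2-exchange =
  split (spread (only a α) ≥ 12)
    (weights (46 ∷ 0 ∷ 0 ∷ 0 ∷ 0 ∷ 0 ∷ 0 ∷ 492 ∷ 0 ∷ 342 ∷ 504 ∷ 2280 ∷ 117 ∷ 288 ∷ 40 ∷ 160 ∷ 0 ∷ 0
               ∷ 84 ∷ 120 ∷ []))
    (split (spread (only b α) ≥ 12)
       (weights (24 ∷ 17 ∷ 0 ∷ 0 ∷ 0 ∷ 0 ∷ 0 ∷ 0 ∷ 102 ∷ 0 ∷ 51 ∷ 60 ∷ 276 ∷ 48 ∷ 48 ∷ 4 ∷ 16 ∷ 0 ∷
                  0 ∷ 18 ∷ 12 ∷ []))
       (split (spread (only a α) ≥ 11)
          (weights (34 ∷ 25 ∷ 0 ∷ 0 ∷ 0 ∷ 0 ∷ 0 ∷ 0 ∷ 0 ∷ 68 ∷ 0 ∷ 68 ∷ 116 ∷ 520 ∷ 18 ∷ 52 ∷ 10 ∷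
                     40 ∷ 0 ∷ 0 ∷ 11 ∷ 30 ∷ []))
          (split (spread (only b α) ≥ 11)
             (weights (24 ∷ 17 ∷ 0 ∷ 0 ∷ 0 ∷ 0 ∷ 0 ∷ 0 ∷ 0 ∷ 0 ∷ 102 ∷ 0 ∷ 51 ∷ 60 ∷ 276 ∷ 48 ∷ 48 ∷
                        4 ∷ 16 ∷ 0 ∷ 0 ∷ 18 ∷ 12 ∷ []))
             (split (spread (only a α) ≥ 10)
                (weights (34 ∷ 25 ∷ 0 ∷ 0 ∷ 0 ∷ 0 ∷ 0 ∷ 0 ∷ 0 ∷ 0 ∷ 0 ∷ 68 ∷ 0 ∷ 68 ∷ 116 ∷ 520 ∷ 18
                           ∷ 52 ∷ 10 ∷ 40 ∷ 0 ∷ 0 ∷ 11 ∷ 30 ∷ []))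
                (split (missed 2F ≥ 7)
                   (weights (102 ∷ 34 ∷ 39 ∷ 0 ∷ 0 ∷ 0 ∷ 0 ∷ 0 ∷ 0 ∷ 0 ∷ 0 ∷ 0 ∷ 0 ∷ 0 ∷ 0 ∷ 30 ∷
                              138 ∷ 24 ∷ 24 ∷ 2 ∷ 8 ∷ 0 ∷ 0 ∷ 9 ∷ 6 ∷ []))
                   (split (spread (only a α) ≥ 9)
                      (weights (28 ∷ 39 ∷ 0 ∷ 0 ∷ 0 ∷ 0 ∷ 0 ∷ 6 ∷ 6 ∷ 0 ∷ 0 ∷ 0 ∷ 0 ∷ 30 ∷ 0 ∷ 30 ∷
                                 63 ∷ 267 ∷ 3 ∷ 18 ∷ 4 ∷ 22 ∷ 0 ∷ 0 ∷ 0 ∷ 24 ∷ []))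
                      (weights (70 ∷ 0 ∷ 0 ∷ 0 ∷ 0 ∷ 0 ∷ 0 ∷ 102 ∷ 102 ∷ 0 ∷ 0 ∷ 0 ∷ 0 ∷ 84 ∷ 0 ∷ 0
                                 ∷ 378 ∷ 1470 ∷ 93 ∷ 93 ∷ 2 ∷ 110 ∷ 0 ∷ 0 ∷ 0 ∷ 210 ∷ []))))))))

optimal-2-2-barren-barren : Certificate
optimal-2-2-barren-barren =
  weights (2 ∷ 2 ∷ 0 ∷ 0 ∷ 0 ∷ 0 ∷ 2 ∷ 2 ∷ 0 ∷ 0 ∷ 2 ∷ 2 ∷ 1 ∷ 1 ∷ 0 ∷ 0 ∷ 2 ∷ 0 ∷ 0 ∷ 2 ∷ [])

optimal-2-2-exchange-barren : Certificate
optimal-2-2-exchange-barren =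
  split (edgeCount ≥ 10)
    (weights (4 ∷ 0 ∷ 10 ∷ 0 ∷ 0 ∷ 0 ∷ 0 ∷ 15 ∷ 20 ∷ 10 ∷ 15 ∷ 12 ∷ 40 ∷ 10 ∷ 10 ∷ 0 ∷ 5 ∷ 0 ∷ 0 ∷ 0
               ∷ 10 ∷ []))
    (split (missed 2F ≥ 4)
       (weights (210 ∷ 92 ∷ 0 ∷ 60 ∷ 0 ∷ 0 ∷ 0 ∷ 0 ∷ 40 ∷ 20 ∷ 0 ∷ 0 ∷ 24 ∷ 0 ∷ 35 ∷ 15 ∷ 0 ∷ 30 ∷ 0
                  ∷ 0 ∷ 10 ∷ 60 ∷ []))
       (weights (11 ∷ 0 ∷ 6 ∷ 6 ∷ 6 ∷ 0 ∷ 0 ∷ 0 ∷ 4 ∷ 2 ∷ 0 ∷ 0 ∷ 25 ∷ 77 ∷ 5 ∷ 3 ∷ 0 ∷ 0 ∷ 12 ∷ 0 ∷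
                  4 ∷ 12 ∷ [])))

optimal-2-2-barren-exchange : Certificate
optimal-2-2-barren-exchange =
  split (edgeCount ≥ 10)
    (weights (4 ∷ 10 ∷ 0 ∷ 0 ∷ 0 ∷ 0 ∷ 0 ∷ 20 ∷ 15 ∷ 15 ∷ 10 ∷ 12 ∷ 40 ∷ 10 ∷ 10 ∷ 0 ∷ 0 ∷ 10 ∷ 0 ∷
               5 ∷ []))
    (split (missed 2F ≥ 4)
       (weights (210 ∷ 92 ∷ 60 ∷ 0 ∷ 0 ∷ 0 ∷ 0 ∷ 0 ∷ 20 ∷ 40 ∷ 0 ∷ 0 ∷ 24 ∷ 0 ∷ 15 ∷ 35 ∷ 0 ∷ 10 ∷
                  60 ∷ 0 ∷ 30 ∷ []))
       (weights (11 ∷ 0 ∷ 6 ∷ 6 ∷ 6 ∷ 0 ∷ 0 ∷ 0 ∷ 2 ∷ 4 ∷ 0 ∷ 0 ∷ 25 ∷ 77 ∷ 3 ∷ 5 ∷ 0 ∷ 4 ∷ 12 ∷ 0 ∷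
                  0 ∷ 12 ∷ [])))

optimal-2-2-exchange-exchange : Certificate
optimal-2-2-exchange-exchange =
  split (spread (only a α) ≥ 7)
    (split (spread (only a α) ≥ 8)
       (weights (3 ∷ 0 ∷ 1 ∷ 0 ∷ 1 ∷ 0 ∷ 0 ∷ 0 ∷ 10 ∷ 6 ∷ 8 ∷ 8 ∷ 7 ∷ 29 ∷ 5 ∷ 5 ∷ 0 ∷ 2 ∷ 2 ∷ 0 ∷ 2
                  ∷ 1 ∷ []))
       (split (spread (only a β) ≥ 7)
          (split (spread (only b β) ≥ 7)
             (split (missed 0F ≥ 2)
                (weights (2 ∷ 0 ∷ 2 ∷ 1 ∷ 0 ∷ 0 ∷ 0 ∷ 0 ∷ 0 ∷ 0 ∷ 0 ∷ 3 ∷ 3 ∷ 3 ∷ 3 ∷ 2 ∷ 10 ∷ 2 ∷ 2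
                           ∷ 0 ∷ 0 ∷ 0 ∷ 0 ∷ 1 ∷ []))
                (split (missed 2F ≥ 5)
                   (weights (2 ∷ 2 ∷ 1 ∷ 0 ∷ 0 ∷ 0 ∷ 0 ∷ 0 ∷ 0 ∷ 0 ∷ 0 ∷ 0 ∷ 4 ∷ 4 ∷ 4 ∷ 4 ∷ 2 ∷ 4 ∷
                              2 ∷ 2 ∷ 0 ∷ 0 ∷ 2 ∷ 0 ∷ 0 ∷ 1 ∷ []))
                   (weights (5 ∷ 0 ∷ 0 ∷ 1 ∷ 0 ∷ 2 ∷ 0 ∷ 0 ∷ 0 ∷ 0 ∷ 0 ∷ 0 ∷ 2 ∷ 0 ∷ 0 ∷ 0 ∷ 1 ∷ 3 ∷
                              0 ∷ 0 ∷ 0 ∷ 0 ∷ 1 ∷ []))))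
             (split (missed 2F ≥ 5)
                (weights (10 ∷ 4 ∷ 0 ∷ 4 ∷ 0 ∷ 0 ∷ 0 ∷ 0 ∷ 0 ∷ 0 ∷ 0 ∷ 0 ∷ 0 ∷ 0 ∷ 0 ∷ 4 ∷ 16 ∷ 2 ∷
                           2 ∷ 0 ∷ 0 ∷ 2 ∷ 1 ∷ 1 ∷ []))
                (weights (5 ∷ 0 ∷ 1 ∷ 0 ∷ 2 ∷ 0 ∷ 0 ∷ 0 ∷ 0 ∷ 0 ∷ 0 ∷ 2 ∷ 0 ∷ 0 ∷ 0 ∷ 1 ∷ 3 ∷ 0 ∷ 0
                           ∷ 0 ∷ 0 ∷ 1 ∷ []))))
          (weights (64 ∷ 0 ∷ 80 ∷ 10 ∷ 0 ∷ 10 ∷ 0 ∷ 0 ∷ 0 ∷ 64 ∷ 56 ∷ 56 ∷ 64 ∷ 72 ∷ 296 ∷ 28 ∷ 32 ∷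
                     11 ∷ 29 ∷ 0 ∷ 0 ∷ 0 ∷ 32 ∷ []))))
    (split (missed 2F ≥ 5)
       (weights (12 ∷ 13 ∷ 0 ∷ 4 ∷ 4 ∷ 0 ∷ 0 ∷ 0 ∷ 0 ∷ 10 ∷ 0 ∷ 1 ∷ 16 ∷ 56 ∷ 8 ∷ 8 ∷ 0 ∷ 2 ∷ 4 ∷ 0
                  ∷ 2 ∷ 8 ∷ []))
       (split (edgeCount ≥ 10)
          (weights (2 ∷ 5 ∷ 0 ∷ 0 ∷ 0 ∷ 0 ∷ 0 ∷ 0 ∷ 0 ∷ 0 ∷ 0 ∷ 0 ∷ 0 ∷ 1 ∷ 5 ∷ []))
          (split (missed 2F ≥ 4)
             (weights (150 ∷ 72 ∷ 0 ∷ 0 ∷ 10 ∷ 10 ∷ 20 ∷ 0 ∷ 0 ∷ 0 ∷ 0 ∷ 0 ∷ 0 ∷ 0 ∷ 24 ∷ 0 ∷ 5 ∷ 5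
                        ∷ 0 ∷ 0 ∷ 30 ∷ 0 ∷ 0 ∷ 30 ∷ []))
             (weights (6 ∷ 0 ∷ 0 ∷ 0 ∷ 2 ∷ 2 ∷ 4 ∷ 0 ∷ 0 ∷ 0 ∷ 0 ∷ 0 ∷ 0 ∷ 0 ∷ 12 ∷ 36 ∷ 1 ∷ 1 ∷ 0 ∷
                        0 ∷ 6 ∷ 0 ∷ 0 ∷ 6 ∷ [])))))

-- Permuting the parts

mirror : Class → Class
mirror A = B
mirror B = A
mirror C = C
mirror a = b
mirror b = a

flip : Fin 3 → Fin 3
flip = transpose 0F 1F

classify-flip : ∀ P light → classify (flip P) light ≡ mirror (classify P light)
classify-flip 0F true  = refl
classify-flip 0F false = refl
classify-flip 1F true  = refl
classify-flip 1F false = refl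
classify-flip 2F _     = refl

miss-transpose : ∀ i j P x y z → miss (transpose i j P) (transpose i j x) (transpose i j y)
    (transpose i j z) ≡ miss P x y z
miss-transpose = from-yes (all? λ i → all? λ j → all? λ P → all? λ x → all? λ y → all? λ z →
  miss (transpose i j P) (transpose i j x) (transpose i j y) (transpose i j z) ℤ.≟ miss P x y z)

total-transpose : ∀ i j x y z → total (transpose i j x) (transpose i j y) (transpose i j z) ≡ total
    x y z
total-transpose = from-yes (all? λ i → all? λ j → all? λ x → all? λ y → all? λ z →
  total (transpose i j x) (transpose i j y) (transpose i j z) ℤ.≟ total x y z)

transpose-involutive : ∀ (i j P : Fin 3) → transpose i j (transpose i j P) ≡ P
transpose-involutive = from-yes (all? {n = 3} λ i → all? λ j → all? λ P →
    transpose i j (transpose i j P) ≟ P)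

transpose-swaps : ∀ (i j : Fin 3) → transpose i j i ≡ j
transpose-swaps = from-yes (all? {n = 3} λ i → all? λ j → transpose i j i ≟ j)

module Relabelling {n} (E : List (Edge n)) where

  open Partition E

  module _ (i j : Fin 3) (c : Fin n → Fin 3) where

    x-transpose : ∀ P → x (transpose i j P) (transpose i j ∘ c) ≡ x P c
    x-transpose P = ∑-cong E λ (_ , e) → let open Triple e in miss-transpose i j P (c p) (c q) (c r)

    x-transpose′ : ∀ P → x P (transpose i j ∘ c) ≡ x (transpose i j P) c
    x-transpose′ P = trans (cong (λ Q → x Q (transpose i j ∘ c)) (sym (transpose-involutive i j P)))
        (x-transpose (transpose i j P))

    Φ-transpose : Φ (transpose i j ∘ c) ≤ Φ c
    Φ-transpose = +-mono-≤ (≤-reflexive (∑-cong E λ (_ , e) →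
        let open Triple e in total-transpose i j (c p) (c q) (c r)))
      (top-lub (transpose i j ∘ c) λ P → subst (_≤ top c) (sym (x-transpose′ P))
          (x≤top (transpose i j P) c))

    minimal-transpose : ∀ {t F₀} → Minimal t F₀ c → Minimal t F₀ (transpose i j ∘ c)
    minimal-transpose min = record
      { margin  = margin
      ; bad     = bad
      ; F-min   = F-min
      ; Φ-min   = λ d → ≤-trans Φ-transpose (Φ-min d)
      ; Φ-bound = ≤-trans (ℤ.*-monoˡ-≤-nonNeg (+ 3) Φ-transpose) Φ-bound
      ; Φ-small = ≤-trans Φ-transpose Φ-small
      }
      where open Minimal min

  worst-last : ∀ {t F₀ c} → Minimal t F₀ c → ∀ P → top c ≡ x P c →
      Extremal t F₀ (transpose P 2F ∘ c)
  worst-last {c = c} min P eq = record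
    { minimal = minimal-transpose P 2F c min
    ; worst   = λ Q → subst₂ _≤_ (sym (x-transpose′ P 2F c Q))
        (trans eq (trans (sym (x-transpose P 2F c P))
            (cong (λ R → x R (transpose P 2F ∘ c)) (transpose-swaps P 2F))))
        (x≤top (transpose P 2F Q) c)
    }

  extremal-flip : ∀ {t F₀ c} → Extremal t F₀ c → Extremal t F₀ (flip ∘ c)
  extremal-flip {c = c} ext = record
    { minimal = minimal-transpose 0F 1F c minimal
    ; worst   = λ P → subst₂ _≤_ (sym (x-transpose′ 0F 1F c P)) (sym (x-transpose 0F 1F c 2F))
        (worst (flip P))
    }
    where open Extremal ext

  module _ {t F₀ c} (ext : Extremal t F₀ c) (ext′ : Extremal t F₀ (flip ∘ c)) where

    private
      module X = Classification E c ext
      module Y = Classification E (flip ∘ c) ext′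

    own-gain-flip : ∀ P y z → gain (miss (flip P)) 2F (flip P) (flip y) (flip z) ≡ gain (miss P) 2F
        P y z
    own-gain-flip = from-yes (all? λ P → all? λ y → all? λ z →
      gain (miss (flip P)) 2F (flip P) (flip y) (flip z) ℤ.≟ gain (miss P) 2F P y z)

    last-gain-flip : ∀ P y z → gain (miss 2F) 2F (flip P) (flip y) (flip z) ≡ gain (miss 2F) 2F P y
        z
    last-gain-flip = from-yes (all? λ P → all? λ y → all? λ z →
      gain (miss 2F) 2F (flip P) (flip y) (flip z) ℤ.≟ gain (miss 2F) 2F P y z)

    balance-flip : ∀ v → Y.balance (flip ∘ c) v ≡ X.balance c v
    balance-flip v = cong₂ (λ s u → s + + 2 * u)
      (at-ext E c v {λ x y z → gain (miss (flip (c v))) 2F (flip x) (flip y) (flip z)}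
          {gain (miss (c v)) 2F} (own-gain-flip (c v)))
      (at-ext E c v {λ x y z → gain (miss 2F) 2F (flip x) (flip y) (flip z)} {gain (miss 2F) 2F}
          (last-gain-flip (c v)))

    -- Renaming the good parts does not affect the light inequality. Hence it interchanges the
    -- numbers of heavy vertices, and the larger one may be assumed to belong to `0F`.
    cls-flip : ∀ v → Y.cls v ≡ mirror (X.cls v)
    cls-flip v = trans (cong (λ s → classify (flip (c v)) ⌊ 0ℤ ℤ.≤? s ⌋) (balance-flip v))
        (classify-flip (c v) _)

    count-flip : ∀ {k l} → (∀ x → does (mirror x ≟ᶜ l) ≡ does (x ≟ᶜ k)) → Y.count l ≡ X.count k
    count-flip {l = l} eq = ∑-cong (allFin n) λ v →
        cong (_⊳ 1ℤ) (trans (cong (λ x → does (x ≟ᶜ l)) (cls-flip v)) (eq (X.cls v)))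

-- Contradiction for all numbers of heavy vertices

module Refutation {n} (E : List (Edge n)) (E! : Unique (map proj₁ E)) {t F₀ : ℤ} (c : Fin n → Fin 3)
                  (ext : Partition.Extremal E t F₀ c) where

  open Classification E c ext
  open Sparse E E! cls t F₀
  open Exchanging E E! cls t F₀ (Partition.Extremal.F-min ext)

  private
    enough : ∀ {k i} → i ℕ.≤ length (members k) → + i ≤ count k
    enough {k} i≤ = subst (_ ≤_) (sym (count≡ k)) (+≤+ i≤)

  module _ {i j} (i≡ : length (members a) ≡ i) (j≡ : length (members b) ≡ j) where

    exactly-holds : All Holds (exactly i j)
    exactly-holds = few-holds a (ℕ.≤-reflexive i≡) ∷ few-holds b (ℕ.≤-reflexive j≡) ∷
                    mixed-holds (λ ()) i≡ j≡ ∷ mixed-holds (λ ()) j≡ i≡ ∷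
                    core-holds (enough (ℕ.≤-reflexive (sym i≡))) (enough (ℕ.≤-reflexive (sym j≡)))

    optimal-holds : All Holds (optimal i j)
    optimal-holds = Φ-form-holds ∷ F-form-holds ∷
      HeavyForms.g₀-holds a-heavy (trans (cong +_ (sym i≡)) (sym (count≡ a))) ∷
      HeavyForms.g₀-holds b-heavy (trans (cong +_ (sym j≡)) (sym (count≡ b))) ∷ exactly-holds

    atLeast-holds : ∀ {k} → k ℕ.≤ i → All Holds (atLeast k j)
    atLeast-holds k≤i = few-holds b (ℕ.≤-reflexive j≡) ∷
                        core-holds (enough (subst (_ ℕ.≤_) (sym i≡) k≤i))
                            (enough (ℕ.≤-reflexive (sym j≡)))

    core-holds′ : ∀ {k l} → k ℕ.≤ i → l ℕ.≤ j → All Holds (core k l)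
    core-holds′ k≤i l≤j = core-holds (enough (subst (_ ℕ.≤_) (sym i≡) k≤i))
        (enough (subst (_ ℕ.≤_) (sym j≡) l≤j))

  -- The systems `atLeast` and `core` cover the unbounded ranges. The alternative
  -- `barren-or-exchange` requires exactly two heavy vertices in the part: it is applied to both
  -- parts at (2, 2) and to the second part at (3, 2).
  refuted : ∀ i j → length (members a) ≡ i → length (members b) ≡ j → j ℕ.≤ i → ⊥
  refuted 0 0 i≡ j≡ _ = refute (exactly 0 0) exactly-0-0 (exactly-holds i≡ j≡) tt
  refuted 1 0 i≡ j≡ _ = refute (exactly 1 0) exactly-1-0 (exactly-holds i≡ j≡) tt
  refuted (suc (suc i)) 0 i≡ j≡ _ = refute (atLeast 2 0) atLeast-2-0
      (atLeast-holds i≡ j≡ (s≤s (s≤s z≤n))) tt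
  refuted 1 1 i≡ j≡ _ = refute (exactly 1 1) exactly-1-1 (exactly-holds i≡ j≡) tt
  refuted 2 1 i≡ j≡ _ = refute (exactly 2 1) exactly-2-1 (exactly-holds i≡ j≡) tt
  refuted 3 1 i≡ j≡ _ = refute (exactly 3 1) exactly-3-1 (exactly-holds i≡ j≡) tt
  refuted 4 1 i≡ j≡ _ = refute (exactly 4 1) exactly-4-1 (exactly-holds i≡ j≡) tt
  refuted 5 1 i≡ j≡ _ = refute (exactly 5 1) exactly-5-1 (exactly-holds i≡ j≡) tt
  refuted (suc (suc (suc (suc (suc (suc i)))))) 1 i≡ j≡ _ =
    refute (atLeast 6 1) atLeast-6-1 (atLeast-holds i≡ j≡ (ℕ.m≤m+n 6 i)) tt
  refuted 2 2 i≡ j≡ _ with barren-or-exchange A-exchange i≡ | barren-or-exchange B-exchange j≡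
  ... | inj₁ h | inj₁ h′ = refute (barren 0F ∷ barren 1F ∷ optimal 2 2) optimal-2-2-barren-barren
      (h ∷ h′ ∷ optimal-holds i≡ j≡) tt
  ... | inj₁ h | inj₂ h′ = refute (barren 0F ∷ exchange 1F B b ∷ optimal 2 2)
      optimal-2-2-barren-exchange (h ∷ h′ ∷ optimal-holds i≡ j≡) tt
  ... | inj₂ h | inj₁ h′ = refute (exchange 0F A a ∷ barren 1F ∷ optimal 2 2)
      optimal-2-2-exchange-barren (h ∷ h′ ∷ optimal-holds i≡ j≡) tt
  ... | inj₂ h | inj₂ h′ = refute (exchange 0F A a ∷ exchange 1F B b ∷ optimal 2 2)
      optimal-2-2-exchange-exchange (h ∷ h′ ∷ optimal-holds i≡ j≡) tt
  refuted 3 2 i≡ j≡ _ with barren-or-exchange B-exchange j≡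
  ... | inj₁ h = refute (barren 1F ∷ optimal 3 2) optimal-3-2-barren (h ∷ optimal-holds i≡ j≡) tt
  ... | inj₂ h = refute (exchange 1F B b ∷ optimal 3 2) optimal-3-2-exchange
      (h ∷ optimal-holds i≡ j≡) tt
  refuted 4 2 i≡ j≡ _ = refute (optimal 4 2) optimal-4-2 (optimal-holds i≡ j≡) tt
  refuted 5 2 i≡ j≡ _ = refute (exactly 5 2) exactly-5-2 (exactly-holds i≡ j≡) tt
  refuted 6 2 i≡ j≡ _ = refute (exactly 6 2) exactly-6-2 (exactly-holds i≡ j≡) tt
  refuted 7 2 i≡ j≡ _ = refute (exactly 7 2) exactly-7-2 (exactly-holds i≡ j≡) tt
  refuted (suc (suc (suc (suc (suc (suc (suc (suc i)))))))) 2 i≡ j≡ _ =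
    refute (atLeast 8 2) atLeast-8-2 (atLeast-holds i≡ j≡ (ℕ.m≤m+n 8 i)) tt
  refuted (suc (suc (suc i))) (suc (suc (suc j))) i≡ j≡ _ =
    refute (core 3 3) core-3-3 (core-holds′ i≡ j≡ (ℕ.m≤m+n 3 i) (ℕ.m≤m+n 3 j)) tt
  refuted 1 (suc (suc _)) _ _ (s≤s ())
  refuted 2 (suc (suc (suc _))) _ _ (s≤s (s≤s ()))

-- Minimisers among all colourings

least₃ : (h : Fin 3 → ℤ) → ∃ λ i → ∀ j → h i ≤ h j
least₃ h with ≤-total (h 0F) (h 1F)
... | inj₁ 0≤1 with ≤-total (h 0F) (h 2F)
...   | inj₁ 0≤2 = 0F , λ { 0F → ≤-refl ; 1F → 0≤1 ; 2F → 0≤2 }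
...   | inj₂ 2≤0 = 2F , λ { 0F → 2≤0 ; 1F → ≤-trans 2≤0 0≤1 ; 2F → ≤-refl }
least₃ h | inj₂ 1≤0 with ≤-total (h 1F) (h 2F)
...   | inj₁ 1≤2 = 1F , λ { 0F → 1≤0 ; 1F → ≤-refl ; 2F → 1≤2 }
...   | inj₂ 2≤1 = 2F , λ { 0F → ≤-trans 2≤1 1≤0 ; 1F → 2≤1 ; 2F → ≤-refl }

-- A best completion is found for each colour of the first vertex, and the three are compared. A
-- colouring d agrees with `head d ▹ tail d` only pointwise, hence the congruence hypothesis.
least : ∀ {n} (f : (Fin n → Fin 3) → ℤ) → (∀ {c d} → (∀ v → c v ≡ d v) → f c ≡ f d) → ∃ λ c → ∀ d →
    f c ≤ f d
least {zero}  f f-cong = (λ ()) , λ d → ≤-reflexive (f-cong λ ())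
least {suc n} f f-cong = i ▹ proj₁ (rest i) , λ d →
  ≤-trans (best (head d)) (≤-trans (proj₂ (rest (head d)) (tail d))
      (≤-reflexive (f-cong λ { zero → refl ; (suc v) → refl })))
  where
  rest : ∀ i → ∃ λ c → ∀ d → f (i ▹ c) ≤ f (i ▹ d)
  rest i = least (λ c → f (i ▹ c)) (λ eq → f-cong λ { zero → refl ; (suc v) → eq v })
  i : Fin 3
  i = proj₁ (least₃ (λ i → f (i ▹ proj₁ (rest i))))
  best : ∀ j → f (i ▹ proj₁ (rest i)) ≤ f (j ▹ proj₁ (rest j))
  best = proj₂ (least₃ (λ i → f (i ▹ proj₁ (rest i))))

-- From subsets to triples, and from missed to met edges

elements : ∀ {n} (s : Subset n) → ∃ λ vs → length vs ≡ ∣ s ∣ × Unique vs × All (_∈ₛ s) vs ×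
    (∀ {v} → v ∈ₛ s → v ∈ vs)
elements [] = [] , refl , [] , [] , λ ()
elements (x ∷ s) with elements s
elements (outside ∷ s) | vs , len , vs! , vs⊆s , s⊆vs =
  map suc vs , trans (length-map suc vs) len , Unique.map⁺ suc-injective vs! ,
  All.tabulate (λ v∈ → let (u , u∈ , eq) = ∈-map⁻ suc v∈ in subst (_∈ₛ outside ∷ s) (sym eq)
      (there (All.lookup vs⊆s u∈))) ,
  λ { (there v∈) → ∈-map⁺ suc (s⊆vs v∈) }
elements (inside ∷ s) | vs , len , vs! , vs⊆s , s⊆vs =
  zero ∷ map suc vs , cong suc (trans (length-map suc vs) len) ,
  All.tabulate (λ v∈ eq → let (u , _ , eq′) = ∈-map⁻ suc v∈ in contradiction (trans eq eq′) λ ()) ∷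
      Unique.map⁺ suc-injective vs! ,
  here ∷ All.tabulate (λ v∈ → let (u , u∈ , eq) = ∈-map⁻ suc v∈ in subst (_∈ₛ inside ∷ s) (sym eq)
      (there (All.lookup vs⊆s u∈))) ,
  λ { here → here refl ; (there v∈) → there (∈-map⁺ suc (s⊆vs v∈)) }

triple : ∀ {n} {s : Subset n} → ∣ s ∣ ≡ 3 → Triple s
triple {s = s} size with elements s
... | p ∷ q ∷ r ∷ [] , _ , (p≢q ∷ p≢r ∷ []) ∷ (q≢r ∷ []) ∷ [] ∷ [] , p∈ ∷ q∈ ∷ r∈ ∷ [] , cover =
    record
  { p≢q = p≢q ; p≢r = p≢r ; q≢r = q≢r ; p∈s = p∈ ; q∈s = q∈ ; r∈s = r∈ ; cover = λ v∈ →
      position (cover v∈) }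
  where
  position : ∀ {v} → v ∈ p ∷ q ∷ r ∷ [] → v ≡ p ⊎ v ≡ q ⊎ v ≡ r
  position (here eq)                 = inj₁ eq
  position (there (here eq))         = inj₂ (inj₁ eq)
  position (there (there (here eq))) = inj₂ (inj₂ eq)
... | []                    , len , _ = contradiction (trans len size) λ ()
... | _ ∷ []                , len , _ = contradiction (trans len size) λ ()
... | _ ∷ _ ∷ []            , len , _ = contradiction (trans len size) λ ()
... | _ ∷ _ ∷ _ ∷ _ ∷ _     , len , _ = contradiction (trans len size) λ ()

triples : ∀ {n} {es : List (Subset n)} → All (λ e → ∣ e ∣ ≡ 3) es → ∃ λ (E : List (Edge n)) →
    map proj₁ E ≡ es
triples []            = [] , refl
triples (size ∷ sizes) with triples sizes
... | E , eq = (_ , triple size) ∷ E , cong (_ ∷_) eq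

module Meeting {n} (c : Fin n → Fin 3) (i : Fin 3) where

  ∈-part⁺ : ∀ {v} → i ≡ c v → v ∈ₛ part c i
  ∈-part⁺ {v} eq = lookup⇒[]= v (part c i) (trans (lookup∘tabulate _ v)
      (dec-true (c v ≟ i) (sym eq)))

  ∈-part⁻ : ∀ {v} → v ∈ₛ part c i → i ≡ c v
  ∈-part⁻ {v} v∈ with c v ≟ i | trans (sym (lookup∘tabulate (λ v → does (c v ≟ i)) v))
      ([]=⇒lookup v∈)
  ... | yes eq | _  = sym eq
  ... | no _   | ()

  miss-some : ∀ i x y z → i ≡ x ⊎ i ≡ y ⊎ i ≡ z → miss i x y z ≡ 0ℤ
  miss-some i x y z (inj₁ eq) rewrite dec-true (i ≟ x) eq = refl
  miss-some i x y z (inj₂ (inj₁ eq)) with does (i ≟ x)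
  ... | true  = refl
  ... | false rewrite dec-true (i ≟ y) eq = refl
  miss-some i x y z (inj₂ (inj₂ eq)) with does (i ≟ x) | does (i ≟ y)
  ... | true  | _     = refl
  ... | false | true  = refl
  ... | false | false rewrite dec-true (i ≟ z) eq = refl

  miss-all : ∀ i x y z → i ≢ x → i ≢ y → i ≢ z → miss i x y z ≡ 1ℤ
  miss-all i x y z i≢x i≢y i≢z rewrite dec-false (i ≟ x) i≢x | dec-false (i ≟ y) i≢y | dec-false
      (i ≟ z) i≢z = refl

  met+missed : ∀ (E : List (Edge n)) →
               + length (filter (meets? (part c i)) (map proj₁ E)) + ⟨_∣_⟩ E (miss i) c ≡ ∑ E
                   (λ _ → 1ℤ)
  met+missed [] = refl
  met+missed ((s , e) ∷ E) with meets? (part c i) s | met+missed E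
  ... | yes (v , v∈part , v∈s) | ih = trans (cong
      (λ m → 1ℤ + + length (filter (meets? (part c i)) (map proj₁ E)) + (m + ⟨_∣_⟩ E (miss i) c))
      hit)
                                        (trans (ring (+ length (filter (meets? (part c i))
                                            (map proj₁ E))) (⟨_∣_⟩ E (miss i) c))
                                            (cong (λ s → 1ℤ + s) ih))
    where
    open Triple e
    ring : ∀ a b → 1ℤ + a + (0ℤ + b) ≡ 1ℤ + (a + b)
    ring = solve-∀
    locate : v ≡ p ⊎ v ≡ q ⊎ v ≡ r → i ≡ c p ⊎ i ≡ c q ⊎ i ≡ c r
    locate (inj₁ refl)        = inj₁ (∈-part⁻ v∈part)
    locate (inj₂ (inj₁ refl)) = inj₂ (inj₁ (∈-part⁻ v∈part))
    locate (inj₂ (inj₂ refl)) = inj₂ (inj₂ (∈-part⁻ v∈part))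
    hit : miss i (c p) (c q) (c r) ≡ 0ℤ
    hit = miss-some i _ _ _ (locate (cover v∈s))
  ... | no ¬meets | ih = trans (cong (λ m → + length (filter (meets? (part c i)) (map proj₁ E)) +
      (m + ⟨_∣_⟩ E (miss i) c)) avoid)
                           (trans (ring (+ length (filter (meets? (part c i)) (map proj₁ E)))
                               (⟨_∣_⟩ E (miss i) c)) (cong (λ s → 1ℤ + s) ih))
    where
    open Triple e
    ring : ∀ a b → a + (1ℤ + b) ≡ 1ℤ + (a + b)
    ring = solve-∀
    avoid : miss i (c p) (c q) (c r) ≡ 1ℤ
    avoid = miss-all i _ _ _ (λ eq → ¬meets (p , ∈-part⁺ eq , p∈s))
        (λ eq → ¬meets (q , ∈-part⁺ eq , q∈s)) (λ eq → ¬meets (r , ∈-part⁺ eq , r∈s))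

-- Existence of the partition

module Existence {n} (E : List (Edge n)) (E! : Unique (map proj₁ E)) where

  open Partition E
  open Relabelling E

  no-extremal : ∀ {t F₀ c} → ¬ Extremal t F₀ c
  no-extremal {t} {F₀} {c} ext with ℕ.≤-total (length (X.members b)) (length (X.members a))
    where module X = Sparse E E! (Classification.cls E c ext) t F₀
  ... | inj₁ b≤a = Refutation.refuted E E! c ext _ _ refl refl b≤a
  ... | inj₂ a≤b = Refutation.refuted E E! (flip ∘ c) ext′ _ _ refl refl
      (subst₂ ℕ._≤_ (same a b flip-a) (same b a flip-b) a≤b)
    where
    ext′ : Extremal t F₀ (flip ∘ c)
    ext′ = extremal-flip ext
    module X = Sparse E E! (Classification.cls E c ext) t F₀
    module Y = Sparse E E! (Classification.cls E (flip ∘ c) ext′) t F₀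
    flip-a : ∀ x → does (mirror x ≟ᶜ b) ≡ does (x ≟ᶜ a)
    flip-a = λ { A → refl ; B → refl ; C → refl ; a → refl ; b → refl }
    flip-b : ∀ x → does (mirror x ≟ᶜ a) ≡ does (x ≟ᶜ b)
    flip-b = λ { A → refl ; B → refl ; C → refl ; a → refl ; b → refl }
    same : ∀ k l → (∀ x → does (mirror x ≟ᶜ l) ≡ does (x ≟ᶜ k)) →
        length (X.members k) ≡ length (Y.members l)
    same k l eq = ℤ.+-injective (trans (sym (X.count≡ k))
        (trans (sym (count-flip ext ext′ eq)) (Y.count≡ l)))

  no-minimal : ∀ {t F₀ c} → ¬ Minimal t F₀ c
  no-minimal {c = c} min with top-attained c
  ... | inj₁ eq        = no-extremal (worst-last min 0F eq)
  ... | inj₂ (inj₁ eq) = no-extremal (worst-last min 1F eq)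
  ... | inj₂ (inj₂ eq) = no-extremal (worst-last min 2F eq)

  module _ (t : ℤ) (margin : + 2 * m + 1ℤ ≤ + 5 * t) where

    -- The witness minimises `top`; if it were bad, every colouring would be bad. This makes the
    -- existence proof constructive.
    balanced : ∃ λ c → ¬ (t ≤ top c)
    balanced with least top top-cong
    ... | c , top-min = c , λ bad → no-minimal {c = c₂} record
      { margin  = margin
      ; bad     = λ d → ≤-trans bad (top-min d)
      ; F-min   = F-min
      ; Φ-min   = proj₂ (least Φ Φ-cong)
      -- With s = `top c₁`, both bounds come from F(c₁) + 3s ≤ 2m, since 3Φ(c₁) = 2F(c₁) + (F(c₁) +
      -- 3s) and Φ(c₁) = (F(c₁) + 3s) - 2s.
      ; Φ-bound = 0≤i-j⇒j≤i (scale 3 Φ-slack and top-slack gives ring₁ (Φ c₂) (F c₁) (top c₁) m)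
      ; Φ-small = 0≤i-j⇒j≤i ((Φ-slack and top-slack gives refl) and scale 2
          (i≤j⇒0≤j-i (≤-trans bad (top-min c₁)))
                             gives ring₂ (Φ c₂) (F c₁) (top c₁) m t)
      }
      where
      c₁ c₂ : Fin n → Fin 3
      c₁ = proj₁ (least F (⟨⟩-cong total))
      c₂ = proj₁ (least Φ Φ-cong)
      F-min : ∀ d → F c₁ ≤ F d
      F-min = proj₂ (least F (⟨⟩-cong total))
      Φ-slack : 0ℤ ≤ F c₁ + top c₁ - Φ c₂
      Φ-slack = i≤j⇒0≤j-i (proj₂ (least Φ Φ-cong) c₁)
      top-slack : 0ℤ ≤ + 2 * m - (F c₁ + + 3 * top c₁)
      top-slack with top-attained c₁
      ... | inj₁ eq        rewrite eq = i≤j⇒0≤j-i (F-min-bound c₁ F-min 0F)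
      ... | inj₂ (inj₁ eq) rewrite eq = i≤j⇒0≤j-i (F-min-bound c₁ F-min 1F)
      ... | inj₂ (inj₂ eq) rewrite eq = i≤j⇒0≤j-i (F-min-bound c₁ F-min 2F)
      ring₁ : ∀ p f s m → + 3 * (f + s - p) + (+ 2 * m - (f + + 3 * s)) ≡ + 2 * f + + 2 * m - + 3 *
          p
      ring₁ = solve-∀
      ring₂ : ∀ p f s m t → f + s - p + (+ 2 * m - (f + + 3 * s)) + + 2 * (s - t) ≡ + 2 * m - + 2 *
          t - p
      ring₂ = solve-∀

solution : ∀ {n} (E : List (Edge n)) → Unique (map proj₁ E) → ∃ λ (c : Fin n → Fin 3) →
           ∀ i → 3 ℕ.* length (map proj₁ E) ℕ.≤ 5 ℕ.* length
               (filter (meets? (part c i)) (map proj₁ E))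
solution {n} E E! = c , enough
  where
  open Partition E
  N : ℕ
  N = length (map proj₁ E)
  -- With q the integer part of 2m/5, the threshold is t = q + 1, and `top` below t means that every
  -- part misses at most q edges.
  q : ℕ
  q = 2 ℕ.* N ℕ./ 5
  m≡N : m ≡ + N
  m≡N = trans (count-edges E) (cong +_ (sym (length-map proj₁ E)))
    where
    count-edges : ∀ (es : List (Edge n)) → ∑ es (λ _ → 1ℤ) ≡ + length es
    count-edges []       = refl
    count-edges (_ ∷ es) = cong (λ s → 1ℤ + s) (count-edges es)
  margin : + 2 * m + 1ℤ ≤ + 5 * + suc q
  margin = subst₂ _≤_ (trans (ℤ.pos-+ (2 ℕ.* N) 1)
      (cong (_+ 1ℤ) (trans (ℤ.pos-* 2 N) (cong (+ 2 *_) (sym m≡N))))) (ℤ.pos-* 5 (suc q))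
    (+≤+ (subst (ℕ._≤ 5 ℕ.* suc q) (ℕ.+-comm 1 (2 ℕ.* N)) bound))
    where
    bound : suc (2 ℕ.* N) ℕ.≤ 5 ℕ.* suc q
    bound = subst₂ ℕ._≤_ (cong suc (sym (m≡m%n+[m/n]*n (2 ℕ.* N) 5))) (ℕ.*-comm (suc q) 5)
              (ℕ.+-monoˡ-≤ (q ℕ.* 5) (m%n<n (2 ℕ.* N) 5))
  c : Fin n → Fin 3
  c = proj₁ (Existence.balanced E E! (+ suc q) margin)
  met : Fin 3 → ℕ
  met i = length (filter (meets? (part c i)) (map proj₁ E))
  enough : ∀ i → 3 ℕ.* N ℕ.≤ 5 ℕ.* met i
  enough i = ℤ.drop‿+≤+ (subst₂ _≤_ (sym (ℤ.pos-* 3 N)) (sym (ℤ.pos-* 5 (met i))) (0≤i-j⇒j≤i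
    (i≤j⇒0≤j-i 2m-bound and scale 5 (i≤j⇒0≤j-i small) gives
      trans (cong (λ s → + 2 * + N - + 5 * + q + + 5 * (+ q - s)) x≡)
          (ring (+ N) (+ q) (+ met i)))))
    where
    ring : ∀ n q k → + 2 * n - + 5 * q + + 5 * (q - (n - k)) ≡ + 5 * k - + 3 * n
    ring = solve-∀
    cancel : ∀ k x → x ≡ k + x - k
    cancel = solve-∀
    2m-bound : + 5 * + q ≤ + 2 * + N
    2m-bound = subst₂ _≤_ (trans (cong +_ (ℕ.*-comm q 5)) (ℤ.pos-* 5 q)) (ℤ.pos-* 2 N)
        (+≤+ (m/n*n≤m (2 ℕ.* N) 5))
    small : x i c ≤ + q
    small = ≤-trans (x≤top i c) (0≤i-j⇒j≤i (subst (0ℤ ≤_) (pred (+ q) (top c))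
      (i≤j⇒0≤j-i (ℤ.i<j⇒suc[i]≤j (ℤ.≰⇒> (proj₂ (Existence.balanced E E! (+ suc q) margin)))))))
      where
      pred : ∀ q s → (1ℤ + q) - (1ℤ + s) ≡ q - s
      pred = solve-∀
    x≡ : x i c ≡ + N - + met i
    x≡ = trans (cancel (+ met i) (x i c)) (cong (_- + met i) (trans (Meeting.met+missed c i E) m≡N))

theorem4 : ∀ {n : ℕ} (G : Hypergraph3 n) →
    ∃ λ (c : Fin n → Fin 3) →
    ∀ (i : Fin 3) → 3 ℕ.* numEdges G ℕ.≤ 5 ℕ.* metCount G (part c i)
theorem4 {n} G with triples (uniform G)
... | E , eq = subst (λ es → ∃ λ (c : Fin n → Fin 3) → ∀ i →
    3 ℕ.* length es ℕ.≤ 5 ℕ.* length (filter (meets? (part c i)) es)) eq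
                     (solution E (subst Unique (sym eq) (distinct G)))
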